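{- Let $k$ be a fixed positive integer. For every $\varepsilon>0$ there exists a constant $c=c(k,\varepsilon)>0$ such that for every prime $p$ and every interval $I\subset\mathbb{F}_p\setminus\{0\}$ with $|I|<p^{1/2}$, $$|k(I^{ -1})|>c\,|I|^{\frac{2k}{k+1}-\varepsilon}.$$
   Context: $\mathbb{F}_p$ is the field of residue classes modulo the prime $p$; $x^{ -1}$ is the inverse in $\mathbb{F}_p$. An interval $I$ in $\mathbb{F}_p$ is a non-empty set of residue classes of consecutive integers $M+1,\dots,M+N$ with $1\le N\le p$, and $|I|=N$. Here $I^{ -1}=\{x^{ -1}: x\in I\}$ and $k(I^{ -1})=\{x_1^{ -1}+\dots+x_k^{ -1}: x_1,\dots,x_k\in I\}\subset\mathbb{F}_p$. -}

module Defs where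

open import Data.Nat.Base as ℕ using (ℕ; NonZero)
open import Data.Integer.Base as ℤ using (ℤ; +_; -[1+_]; _%ℕ_)
open import Data.Integer.DivMod using (n%ℕd<d)
open import Data.Rational.Base using (ℚ; 0ℚ; 1ℚ; _<_; _≤_; _*_; _-_; _/_; ↥_; ↧ₙ_; +-*-rawSemiring)
open import Data.Fin.Base using (Fin; toℕ; fromℕ<)
open import Data.Fin.Properties using (any?; _≟_)
open import Data.Fin.Subset using (Subset; _∈_)
open import Data.Fin.Subset.Properties using (_∈?_)
open import Data.Vec.Base using (Vec; []; _∷_; tabulate; foldr′)
open import Data.Vec.Relation.Unary.All using (All; all?)
open import Data.Product.Base using (∃; ∃₂; _×_; _,_)
open import Data.Sum.Base using (_⊎_)
open import Function.Base using (_∘_)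
open import Function.Bundles using (_⇔_)
open import Relation.Binary.PropositionalEquality.Core using (_≡_)
open import Relation.Nullary.Decidable using (Dec; does; map′; _×-dec_)
open import Relation.Nullary.Negation using (¬_)
open import Relation.Unary using (Pred; Decidable)
open import Level using (0ℓ)
open import Algebra.Definitions.RawSemiring +-*-rawSemiring using () renaming (_^_ to _^ℚ_)

-- Dedekind reals: lower q means q < x, upper q means x < q.
record ℝ : Set₁ where
  field
    lower upper     : ℚ → Set
    lower-inhabited : ∃ lower
    upper-inhabited : ∃ upper
    lower-rounded   : ∀ q → lower q ⇔ (∃ λ r → q < r × lower r)
    upper-rounded   : ∀ q → upper q ⇔ (∃ λ r → r < q × upper r)
    disjoint        : ∀ q → ¬ (lower q × upper q)
    located         : ∀ {q r} → q < r → lower q ⊎ upper r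

open ℝ public

Positive : ℝ → Set
Positive x = lower x 0ℚ

fromℕ : ℕ → ℚ
fromℕ n = + n / 1

-- The real expression c N^(a - ε) is only compared with a rational lying above
-- it, so it is represented by its upper cut: U q means that its value is < q.
UpperCut : Set₁
UpperCut = ℚ → Set

infix 4 _≺_
_≺_ : UpperCut → ℚ → Set
U ≺ q = U q

-- a - ε < q  iff  a - q < ε
infixl 6 _⊖_
_⊖_ : ℚ → ℝ → UpperCut
(a ⊖ ε) q = lower ε (a - q)

-- N^s < t for N ≥ 1 and s = a / b rational: since N^s > 0, this says that t > 0
-- and N^a < t^b, where N^a < t^b reads 1 < N^(-a) t^b if a is negative.
RationalPower< : ℕ → ℚ → ℚ → Set
RationalPower< N s t = 0ℚ < t × compare (↥ s)
  where
  compare : ℤ → Set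
  compare (+ n)    = fromℕ (N ℕ.^ n) < t ^ℚ (↧ₙ s)
  compare -[1+ n ] = 1ℚ < fromℕ (N ℕ.^ ℕ.suc n) * t ^ℚ (↧ₙ s)

-- For N ≥ 1 and α real, N^α is the infimum of N^s over the rationals s > α.
infixr 8 _^ᵁ_
_^ᵁ_ : ℕ → UpperCut → UpperCut
(N ^ᵁ α) t = ∃ λ s → α s × RationalPower< N s t

-- Product of a positive real and a positive upper cut.
infixl 7 _·_
_·_ : ℝ → UpperCut → UpperCut
(c · U) t = ∃₂ λ d u → upper c d × U u × d * u ≤ t

comprehension : ∀ {n} {P : Pred (Fin n) 0ℓ} → Decidable P → Subset n
comprehension P? = tabulate (does ∘ P?)

anyVec? : ∀ {n} k {P : Pred (Vec (Fin n) k) 0ℓ} → Decidable P → Dec (∃ P)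
anyVec? ℕ.zero    P? = map′ (λ h → [] , h) (λ { ([] , h) → h }) (P? [])
anyVec? (ℕ.suc k) P? =
  map′ (λ { (x , xs , h) → (x ∷ xs) , h }) (λ { ((x ∷ xs) , h) → x , xs , h })
       (any? λ x → anyVec? k (λ xs → P? (x ∷ xs)))

-- Fin p with arithmetic modulo p; this is the field 𝔽_p when p is prime.
module _ {p : ℕ} .{{_ : NonZero p}} where

  residue : ℤ → Fin p
  residue z = fromℕ< (n%ℕd<d z p)

  0ₚ 1ₚ : Fin p
  0ₚ = residue (+ 0)
  1ₚ = residue (+ 1)

  infixl 6 _+ₚ_
  infixl 7 _*ₚ_

  _+ₚ_ _*ₚ_ : Fin p → Fin p → Fin p
  x +ₚ y = residue (+ toℕ x ℤ.+ + toℕ y)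
  x *ₚ y = residue (+ toℕ x ℤ.* + toℕ y)

  sumₚ : ∀ {k} → Vec (Fin p) k → Fin p
  sumₚ = foldr′ _+ₚ_ 0ₚ

  IsInterval : Subset p → Set
  IsInterval I = ∃₂ λ (M : ℤ) (N : ℕ) →
    1 ℕ.≤ N × N ℕ.≤ p ×
    (∀ x → x ∈ I ⇔ (∃ λ j → 1 ℕ.≤ j × j ℕ.≤ N × x ≡ residue (M ℤ.+ + j)))

  -- For p prime, the y with x y = 1 is unique if it exists, and exists iff x ≠ 0.
  inverses : Subset p → Subset p
  inverses I = comprehension λ y → any? λ x → (x ∈? I) ×-dec (x *ₚ y ≟ 1ₚ)

  -- { y₁ + … + y_k : y₁, …, y_k ∈ A }
  sumset : ℕ → Subset p → Subset p
  sumset k A = comprehension λ s →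
    anyVec? k λ ys → all? (_∈? A) ys ×-dec (sumₚ ys ≟ s)

{-# OPTIONS --safe #-}

-- Let I = {M+1, …, M+N} with N² < p. For y and q with y + q x ∈ I for all x < X, the
-- sums of k reciprocals 1/(y + q x) are, up to the factor 1/q, sums of reciprocals
-- 1/(z + x) with z = y/q. Two k-tuples of x's that differ as sets give equal sums for
-- at most 2k values of z, because z is then a root of a nonzero polynomial of degree
-- at most 2k. If the fractions y/q take many more than X^k values, some z has few
-- collisions, so ≫ X^k sums are distinct. With y in a range of length ≍ N and q ≤ Q
-- ≍ N/X there are ≫ NQ fractions (pairs with the same z form an arithmetic
-- progression, and long progressions are rare), so X ≍ N^(2/(k+1)) is admissible and
-- |k(I⁻¹)| ≫ N^(2k/(k+1)), even without ε.
module Submission where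

open import Defs
open import Data.Nat.Base as ℕ using (ℕ; zero; suc; NonZero; _+_; _*_; _^_; _<_; _≤_; z≤n; s≤s)
open import Data.Nat.Primality using (Prime; euclidsLemma; prime⇒nonTrivial)
open import Data.Integer.Base using (ℤ; +_; 0ℤ; 1ℤ)
open import Data.Rational.Base as ℚ using (ℚ; mkℚ; _/_)
open import Data.Fin.Subset using (Subset; _∈_; _∉_; ∣_∣)
open import Data.Product.Base using (Σ-syntax; ∃; ∃₂; _×_; _,_; proj₁; proj₂; uncurry)

open import Data.Bool.Base using (true; false)
open import Data.Fin.Base as Fin using (Fin; zero; suc; toℕ; combine; remQuot; quotient; remainder; join)
import Data.Fin.Properties as Fin
open import Data.Fin.Subset.Properties using (_∈?_)
import Data.Integer.Base as ℤ hiding (+_)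
import Data.Integer.Divisibility.Signed as ℤ
import Data.Integer.DivMod as ℤ
import Data.Integer.Properties as ℤ
open import Data.Integer.Tactic.RingSolver using (solve-∀)
open import Data.Nat.Coprimality as Coprime using (prime⇒coprime; coprime-Bézout; 1-coprimeTo)
import Data.Nat.Divisibility as ℕ
import Data.Nat.DivMod as ℕ
open import Data.Nat.GCD using (gcd; module Bézout)
open import Data.Nat.Induction using (<-rec)
import Data.Nat.Properties as ℕ
import Data.Nat.Tactic.RingSolver as ℕ
import Data.Rational.Properties as ℚ
open import Algebra.Definitions.RawSemiring ℚ.+-*-rawSemiring using () renaming (_^_ to _^ℚ_)
open import Data.Sum.Base using (_⊎_; inj₁; inj₂; [_,_]′)
import Data.Sum.Base as Sum using (map₂)
import Data.Sum.Properties as Sum using (inj₁-injective; inj₂-injective)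
open import Data.Vec.Base using (Vec; []; _∷_; here; there; map; zipWith; replicate)
import Data.Vec.Properties as Vec
open import Data.Vec.Relation.Unary.All as All using (All; []; _∷_; all?)
import Data.Vec.Relation.Unary.All.Properties as All using (map⁺)
open import Function.Bundles using (mk⇔; module Equivalence)
open import Level using (0ℓ)
open import Relation.Binary.Bundles using (Setoid)
open import Relation.Binary.Definitions using (tri<; tri≈; tri>)
open import Relation.Binary.PropositionalEquality
  using (_≡_; _≢_; refl; sym; trans; cong; cong₂; subst; subst₂; module ≡-Reasoning)
import Relation.Binary.Reasoning.Setoid as SetoidReasoning
open import Relation.Nullary using (¬_; Dec; yes; no; contradiction)
open import Relation.Nullary.Decidable using (map′; dec-true; _×-dec_)
open import Relation.Unary using (Pred; Decidable)

-- The delicate point is to count distinct fractions: A is arbitrary modulo p, so coprimality of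
-- numerator and denominator cannot select one pair (q , u) for each value z ≡ (A + u) / q. Instead
-- each z keeps its pair of smallest denominator, its root. The pairs of one z satisfy a linear
-- congruence, and the bound 2 Q U ≤ p, the main use of |I| < p^(1/2), turns it into collinearity
-- over the integers. If a pair lies i > 0 steps (d , w) beyond its root, then z ≡ w / d; for large
-- i both d and w are small, so such z are quotients from a much smaller box. That box is too small
-- to account for all pairs, and the remaining ones must come from roots.
--
-- The collision polynomial is nonzero modulo p because the entries of a tuple are drawn from
-- disjoint blocks: of two different tuples, the first has an entry x that occurs in it once and is
-- missing from the second, so that -x is a simple root of one product and no root of the other.

-- Enumeration of finite subsets

index : ∀ {n} (S : Subset n) {x} → x ∈ S → Fin ∣ S ∣
index (true  ∷ S) here      = zero
index (true  ∷ S) (there h) = suc (index S h)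
index (false ∷ S) (there h) = index S h

index-injective : ∀ {n} (S : Subset n) {x y} (x∈S : x ∈ S) (y∈S : y ∈ S) →
                  index S x∈S ≡ index S y∈S → x ≡ y
index-injective (true  ∷ S) here      here      eq = refl
index-injective (true  ∷ S) (there h) (there g) eq = cong suc (index-injective S h g (Fin.suc-injective eq))
index-injective (false ∷ S) (there h) (there g) eq = cong suc (index-injective S h g eq)

element : ∀ {n} (S : Subset n) → Fin ∣ S ∣ → Fin n
element (true  ∷ S) zero    = zero
element (true  ∷ S) (suc i) = suc (element S i)
element (false ∷ S) i       = suc (element S i)

element-∈ : ∀ {n} (S : Subset n) i → element S i ∈ S
element-∈ (true  ∷ S) zero    = here
element-∈ (true  ∷ S) (suc i) = there (element-∈ S i)
element-∈ (false ∷ S) i       = there (element-∈ S i)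

element-injective : ∀ {n} (S : Subset n) {i j} → element S i ≡ element S j → i ≡ j
element-injective (true  ∷ S) {zero}  {zero}  eq = refl
element-injective (true  ∷ S) {suc i} {suc j} eq = cong suc (element-injective S (Fin.suc-injective eq))
element-injective (false ∷ S)                 eq = element-injective S (Fin.suc-injective eq)

element-index : ∀ {n} (S : Subset n) {x} (x∈S : x ∈ S) → element S (index S x∈S) ≡ x
element-index (true  ∷ S) here      = refl
element-index (true  ∷ S) (there h) = cong suc (element-index S h)
element-index (false ∷ S) (there h) = cong suc (element-index S h)

∈-comprehension⁺ : ∀ {n} {P : Pred (Fin n) 0ℓ} (P? : Decidable P) {x} → P x → x ∈ comprehension P?
∈-comprehension⁺ P? {x} px =
  Vec.lookup⇒[]= x _ (trans (Vec.lookup∘tabulate _ x) (dec-true (P? x) px))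

∈-comprehension⁻ : ∀ {n} {P : Pred (Fin n) 0ℓ} (P? : Decidable P) {x} → x ∈ comprehension P? → P x
∈-comprehension⁻ P? {x} h with P? x | trans (sym (Vec.lookup∘tabulate _ x)) (Vec.[]=⇒lookup h)
... | yes px | _ = px

∣m-n∣<b : ∀ {m n b} → m < b → n < b → ℤ.∣ + m ℤ.- + n ∣ < b
∣m-n∣<b {m} {n} m<b n<b rewrite ℤ.[+m]-[+n]≡m⊖n m n =
  ℕ.≤-<-trans (ℤ.∣m⊝n∣≤m⊔n m n) (ℕ.⊔-lub m<b n<b)

join-injective : ∀ m n {x y} → join m n x ≡ join m n y → x ≡ y
join-injective m n {x} {y} eq =
  trans (sym (Fin.splitAt-join m n x)) (trans (cong (Fin.splitAt m) eq) (Fin.splitAt-join m n y))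

-- Congruences modulo p and inverses modulo a prime

module Congruence (p : ℕ) where

  infix 4 _≈_

  -- Residues are handled as integers up to congruence, not as elements of `Fin p`: identities can
  -- then be solved over ℤ, and `≈-small` recovers equality of integers from a congruence.
  record _≈_ (x y : ℤ) : Set where
    constructor cong-by
    field
      multiple : ℤ
      equation : x ≡ y ℤ.+ multiple ℤ.* + p

  ≈-reflexive : ∀ {x y} → x ≡ y → x ≈ y
  ≈-reflexive {x} refl = cong-by 0ℤ (lemma x (+ p))
    where
    lemma : ∀ x n → x ≡ x ℤ.+ 0ℤ ℤ.* n
    lemma = solve-∀

  ≈-refl : ∀ {x} → x ≈ x
  ≈-refl = ≈-reflexive refl

  ≈-sym : ∀ {x y} → x ≈ y → y ≈ x
  ≈-sym {x} {y} (cong-by m refl) = cong-by (ℤ.- m) (lemma y m (+ p))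
    where
    lemma : ∀ y m n → y ≡ y ℤ.+ m ℤ.* n ℤ.+ (ℤ.- m) ℤ.* n
    lemma = solve-∀

  ≈-trans : ∀ {x y z} → x ≈ y → y ≈ z → x ≈ z
  ≈-trans {z = z} (cong-by m refl) (cong-by l refl) = cong-by (l ℤ.+ m) (lemma z l m (+ p))
    where
    lemma : ∀ z l m n → z ℤ.+ l ℤ.* n ℤ.+ m ℤ.* n ≡ z ℤ.+ (l ℤ.+ m) ℤ.* n
    lemma = solve-∀

  setoid : Setoid 0ℓ 0ℓ
  setoid = record
    { Carrier = ℤ ; _≈_ = _≈_
    ; isEquivalence = record { refl = ≈-refl ; sym = ≈-sym ; trans = ≈-trans } }

  +-cong : ∀ {x y u v} → x ≈ y → u ≈ v → x ℤ.+ u ≈ y ℤ.+ v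
  +-cong {y = y} {v = v} (cong-by m refl) (cong-by l refl) = cong-by (m ℤ.+ l) (lemma y v m l (+ p))
    where
    lemma : ∀ y v m l n → (y ℤ.+ m ℤ.* n) ℤ.+ (v ℤ.+ l ℤ.* n) ≡ y ℤ.+ v ℤ.+ (m ℤ.+ l) ℤ.* n
    lemma = solve-∀

  *-cong : ∀ {x y u v} → x ≈ y → u ≈ v → x ℤ.* u ≈ y ℤ.* v
  *-cong {y = y} {v = v} (cong-by m refl) (cong-by l refl) =
    cong-by (y ℤ.* l ℤ.+ m ℤ.* v ℤ.+ m ℤ.* l ℤ.* + p) (lemma y v m l (+ p))
    where
    lemma : ∀ y v m l n → (y ℤ.+ m ℤ.* n) ℤ.* (v ℤ.+ l ℤ.* n) ≡
                          y ℤ.* v ℤ.+ (y ℤ.* l ℤ.+ m ℤ.* v ℤ.+ m ℤ.* l ℤ.* n) ℤ.* n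
    lemma = solve-∀

  +-congˡ : ∀ x {u v} → u ≈ v → x ℤ.+ u ≈ x ℤ.+ v
  +-congˡ x = +-cong (≈-refl {x})

  *-congˡ : ∀ x {u v} → u ≈ v → x ℤ.* u ≈ x ℤ.* v
  *-congˡ x = *-cong (≈-refl {x})

  *-congʳ : ∀ x {u v} → u ≈ v → u ℤ.* x ≈ v ℤ.* x
  *-congʳ x u≈v = *-cong u≈v (≈-refl {x})

  -‿cong : ∀ {x y u v} → x ≈ y → u ≈ v → x ℤ.- u ≈ y ℤ.- v
  -‿cong {y = y} {v = v} (cong-by m refl) (cong-by l refl) = cong-by (m ℤ.- l) (lemma y v m l (+ p))
    where
    lemma : ∀ y v m l n → (y ℤ.+ m ℤ.* n) ℤ.- (v ℤ.+ l ℤ.* n) ≡ y ℤ.- v ℤ.+ (m ℤ.- l) ℤ.* n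
    lemma = solve-∀

  ∣⇒≈0 : ∀ {x} → p ℕ.∣ ℤ.∣ x ∣ → x ≈ 0ℤ
  ∣⇒≈0 {x} h with ℤ.divides m eq ← ℤ.∣ᵤ⇒∣ {+ p} {x} h = cong-by m (trans eq (sym (ℤ.+-identityˡ _)))

  ≈0⇒∣ : ∀ {x} → x ≈ 0ℤ → p ℕ.∣ ℤ.∣ x ∣
  ≈0⇒∣ {x} (cong-by m eq) = ℤ.∣⇒∣ᵤ {+ p} {x} (ℤ.divides m (trans eq (ℤ.+-identityˡ _)))

  -≈0⇒≈ : ∀ {x y} → x ℤ.- y ≈ 0ℤ → x ≈ y
  -≈0⇒≈ {x} {y} h = begin
    x                  ≡⟨ lemma x y ⟩
    y ℤ.+ (x ℤ.- y)    ≈⟨ +-congˡ y h ⟩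
    y ℤ.+ 0ℤ           ≡⟨ ℤ.+-identityʳ y ⟩
    y                  ∎
    where
    open SetoidReasoning setoid
    lemma : ∀ x y → x ≡ y ℤ.+ (x ℤ.- y)
    lemma = solve-∀

  ≈⇒-≈0 : ∀ {x y} → x ≈ y → x ℤ.- y ≈ 0ℤ
  ≈⇒-≈0 {x} {y} h = ≈-trans (-‿cong h (≈-refl {y})) (≈-reflexive (ℤ.+-inverseʳ y))

  infix 4 _≈?_
  _≈?_ : ∀ x y → Dec (x ≈ y)
  x ≈? y = map′ (λ h → -≈0⇒≈ (∣⇒≈0 h)) (λ h → ≈0⇒∣ (≈⇒-≈0 h)) (p ℕ.∣? ℤ.∣ x ℤ.- y ∣)

  ≈0-small : ∀ {x} → x ≈ 0ℤ → ℤ.∣ x ∣ < p → x ≡ 0ℤ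
  ≈0-small {x} h lt with ℤ.∣ x ∣ in eq | ≈0⇒∣ h
  ... | zero  | _   = ℤ.∣i∣≡0⇒i≡0 eq
  ... | suc n | div = contradiction (ℕ.∣⇒≤ div) (ℕ.<⇒≱ lt)

  ≈-small : ∀ {x y} → x ≈ y → ℤ.∣ x ℤ.- y ∣ < p → x ≡ y
  ≈-small {x} {y} h lt = ℤ.i-j≡0⇒i≡j x y (≈0-small (≈⇒-≈0 h) lt)

  +-≈-small : ∀ {m n} → + m ≈ + n → m < p → n < p → m ≡ n
  +-≈-small h m<p n<p = ℤ.+-injective (≈-small h (∣m-n∣<b m<p n<p))

  +≉0 : ∀ {n} → 0 < n → n < p → ¬ + n ≈ 0ℤ
  +≉0 0<n n<p h = ℕ.<-irrefl (sym (+-≈-small {n = 0} h n<p (ℕ.<-trans 0<n n<p))) 0<n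

module PrimeField (p : ℕ) .{{nz : NonZero p}} (p-prime : Prime p) where

  open Congruence p public

  1≉0 : ¬ 1ℤ ≈ 0ℤ
  1≉0 = +≉0 (s≤s z≤n) (ℕ.nonTrivial⇒n>1 p {{prime⇒nonTrivial p-prime}})

  *≈0 : ∀ x y → x ℤ.* y ≈ 0ℤ → x ≈ 0ℤ ⊎ y ≈ 0ℤ
  *≈0 x y h with euclidsLemma ℤ.∣ x ∣ ℤ.∣ y ∣ p-prime (subst (p ℕ.∣_) (ℤ.abs-* x y) (≈0⇒∣ h))
  ... | inj₁ d = inj₁ (∣⇒≈0 d)
  ... | inj₂ d = inj₂ (∣⇒≈0 d)

  *≉0 : ∀ {x y} → ¬ x ≈ 0ℤ → ¬ y ≈ 0ℤ → ¬ x ℤ.* y ≈ 0ℤ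
  *≉0 {x} {y} x≉0 y≉0 h with *≈0 x y h
  ... | inj₁ e = x≉0 e
  ... | inj₂ e = y≉0 e

  *-cancelʳ : ∀ x y {c} → ¬ c ≈ 0ℤ → x ℤ.* c ≈ y ℤ.* c → x ≈ y
  *-cancelʳ x y {c} c≉0 h =
    [ -≈0⇒≈ , (λ c≈0 → contradiction c≈0 c≉0) ]′
    (*≈0 (x ℤ.- y) c (≈-trans (≈-reflexive (lemma x y c)) (≈⇒-≈0 h)))
    where
    lemma : ∀ x y c → (x ℤ.- y) ℤ.* c ≡ x ℤ.* c ℤ.- y ℤ.* c
    lemma = solve-∀

  %-≈ : ∀ x → + (x ℤ.%ℕ p) ≈ x
  %-≈ x = ≈-sym (cong-by (x ℤ./ℕ p) (ℤ.a≡a%ℕn+[a/ℕn]*n x p))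

  inverse-+ : ∀ r .{{_ : NonZero r}} → r < p → ∃ λ y → + r ℤ.* y ≈ 1ℤ
  inverse-+ r r<p with coprime-Bézout (prime⇒coprime p-prime r<p)
  ... | Bézout.+- a b eq = ℤ.- + b , cong-by (ℤ.- + a) (begin
    + r ℤ.* (ℤ.- + b)                  ≡⟨ lemma (+ b) (+ r) ⟩
    1ℤ ℤ.- (1ℤ ℤ.+ + b ℤ.* + r)        ≡⟨ cong (λ v → 1ℤ ℤ.- (1ℤ ℤ.+ v)) (ℤ.pos-* b r) ⟨
    1ℤ ℤ.- + (1 + b * r)               ≡⟨ cong (λ v → 1ℤ ℤ.- + v) eq ⟩
    1ℤ ℤ.- + (a * p)                   ≡⟨ cong (λ v → 1ℤ ℤ.- v) (ℤ.pos-* a p) ⟩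
    1ℤ ℤ.- + a ℤ.* + p                 ≡⟨ cong (λ v → 1ℤ ℤ.+ v) (ℤ.neg-distribˡ-* (+ a) (+ p)) ⟩
    1ℤ ℤ.+ (ℤ.- + a) ℤ.* + p           ∎)
    where
    open ≡-Reasoning
    lemma : ∀ b r → r ℤ.* (ℤ.- b) ≡ 1ℤ ℤ.- (1ℤ ℤ.+ b ℤ.* r)
    lemma = solve-∀
  ... | Bézout.-+ a b eq = + b , cong-by (+ a) (begin
    + r ℤ.* + b                        ≡⟨ ℤ.*-comm (+ r) (+ b) ⟩
    + b ℤ.* + r                        ≡⟨ ℤ.pos-* b r ⟨
    + (b * r)                          ≡⟨ cong +_ eq ⟨
    1ℤ ℤ.+ + (a * p)                   ≡⟨ cong (λ v → 1ℤ ℤ.+ v) (ℤ.pos-* a p) ⟩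
    1ℤ ℤ.+ + a ℤ.* + p                 ∎)
    where open ≡-Reasoning

  inverse : ∀ x → ¬ x ≈ 0ℤ → ∃ λ y → x ℤ.* y ≈ 1ℤ
  inverse x x≉0 with x ℤ.%ℕ p in eq | ℤ.n%ℕd<d x p
  ... | zero      | _   = contradiction (≈-trans (≈-sym (%-≈ x)) (≈-reflexive (cong +_ eq))) x≉0
  ... | r@(suc _) | r<p =
    let y , ry≈1 = inverse-+ r r<p
    in y , ≈-trans (*-congʳ y (≈-trans (≈-sym (%-≈ x)) (≈-reflexive (cong +_ eq)))) ry≈1

  abstract
    invertible? : ∀ x → x ≈ 0ℤ ⊎ ∃ λ y → x ℤ.* y ≈ 1ℤ
    invertible? x with x ≈? 0ℤ
    ... | yes x≈0 = inj₁ x≈0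
    ... | no  x≉0 = inj₂ (inverse x x≉0)

  -- The value 0 at multiples of p is a default that makes the function total; `*-inv` speaks of the
  -- other arguments.
  inv : ℤ → ℤ
  inv x = [ (λ _ → 0ℤ) , proj₁ ]′ (invertible? x)

  *-inv : ∀ x → ¬ x ≈ 0ℤ → x ℤ.* inv x ≈ 1ℤ
  *-inv x x≉0 with invertible? x
  ... | inj₁ x≈0       = contradiction x≈0 x≉0
  ... | inj₂ (_ , xy≈1) = xy≈1

-- Polynomials with integer coefficients

eval : ∀ {n} → Vec ℤ n → ℤ → ℤ
eval []       z = 0ℤ
eval (c ∷ cs) z = c ℤ.+ z ℤ.* eval cs z

infix 4 _HasDegree<_
_HasDegree<_ : (ℤ → ℤ) → ℕ → Set
f HasDegree< n = Σ[ c ∈ Vec ℤ n ] (∀ z → f z ≡ eval c z)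

raise : ∀ {n} → Vec ℤ n → Vec ℤ (suc n)
raise []       = 0ℤ ∷ []
raise (c ∷ cs) = c ∷ raise cs

eval-raise : ∀ {n} (c : Vec ℤ n) z → eval (raise c) z ≡ eval c z
eval-raise []       z = trans (ℤ.+-identityˡ _) (ℤ.*-zeroʳ z)
eval-raise (c ∷ cs) z = cong (λ v → c ℤ.+ z ℤ.* v) (eval-raise cs z)

eval-zipWith-+ : ∀ {n} (c d : Vec ℤ n) z → eval (zipWith ℤ._+_ c d) z ≡ eval c z ℤ.+ eval d z
eval-zipWith-+ []       []       z = refl
eval-zipWith-+ (c ∷ cs) (d ∷ ds) z =
  trans (cong (λ v → c ℤ.+ d ℤ.+ z ℤ.* v) (eval-zipWith-+ cs ds z)) (lemma c d z (eval cs z) (eval ds z))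
  where
  lemma : ∀ c d z u v → c ℤ.+ d ℤ.+ z ℤ.* (u ℤ.+ v) ≡ c ℤ.+ z ℤ.* u ℤ.+ (d ℤ.+ z ℤ.* v)
  lemma = solve-∀

eval-map-* : ∀ {n} a (c : Vec ℤ n) z → eval (map (a ℤ.*_) c) z ≡ a ℤ.* eval c z
eval-map-* a []       z = sym (ℤ.*-zeroʳ a)
eval-map-* a (c ∷ cs) z = trans (cong (λ v → a ℤ.* c ℤ.+ z ℤ.* v) (eval-map-* a cs z)) (lemma a c z (eval cs z))
  where
  lemma : ∀ a c z u → a ℤ.* c ℤ.+ z ℤ.* (a ℤ.* u) ≡ a ℤ.* (c ℤ.+ z ℤ.* u)
  lemma = solve-∀

degree-raise : ∀ {f n} → f HasDegree< n → f HasDegree< suc n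
degree-raise (c , f≡c) = raise c , λ z → trans (f≡c z) (sym (eval-raise c z))

degree-+ : ∀ {f g n} → f HasDegree< n → g HasDegree< n → (λ z → f z ℤ.+ g z) HasDegree< n
degree-+ (c , f≡c) (d , g≡d) =
  zipWith ℤ._+_ c d , λ z → trans (cong₂ ℤ._+_ (f≡c z) (g≡d z)) (sym (eval-zipWith-+ c d z))

degree-scale : ∀ {f n} a → f HasDegree< n → (λ z → a ℤ.* f z) HasDegree< n
degree-scale a (c , f≡c) = map (a ℤ.*_) c , λ z → trans (cong (a ℤ.*_) (f≡c z)) (sym (eval-map-* a c z))

degree-linear : ∀ {f n} x → f HasDegree< n → (λ z → (z ℤ.+ x) ℤ.* f z) HasDegree< suc n
degree-linear {f} {n} x f<n@(c , f≡c) =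
  let d , eq = degree-+ shifted (degree-raise (degree-scale x f<n)) in
  d , λ z → trans (ℤ.*-distribʳ-+ (f z) z x) (eq z)
  where
  shifted : (λ z → z ℤ.* f z) HasDegree< suc n
  shifted = 0ℤ ∷ c , λ z → trans (cong (z ℤ.*_) (f≡c z)) (sym (ℤ.+-identityˡ _))

degree-cong : ∀ {f g n} → (∀ z → g z ≡ f z) → f HasDegree< n → g HasDegree< n
degree-cong g≡f (c , f≡c) = c , λ z → trans (g≡f z) (f≡c z)

-- Horner's scheme: the coefficients of the quotient by z - r are the intermediate values of the
-- evaluation at r.
synthetic-quotient : ∀ {n} → ℤ → Vec ℤ (suc n) → Vec ℤ n
synthetic-quotient {zero}  r (c ∷ []) = []
synthetic-quotient {suc n} r (c ∷ cs) = eval cs r ∷ synthetic-quotient r cs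

factor-theorem : ∀ {n} r (c : Vec ℤ (suc n)) z →
                 eval c z ≡ eval c r ℤ.+ (z ℤ.- r) ℤ.* eval (synthetic-quotient r c) z
factor-theorem {zero}  r (c ∷ []) z = lemma c z r
  where
  lemma : ∀ c z r → c ℤ.+ z ℤ.* 0ℤ ≡ c ℤ.+ r ℤ.* 0ℤ ℤ.+ (z ℤ.- r) ℤ.* 0ℤ
  lemma = solve-∀
factor-theorem {suc n} r (c ∷ cs) z =
  trans (cong (λ v → c ℤ.+ z ℤ.* v) (factor-theorem r cs z)) (lemma c z r (eval cs r) _)
  where
  lemma : ∀ c z r u q → c ℤ.+ z ℤ.* (u ℤ.+ (z ℤ.- r) ℤ.* q) ≡ c ℤ.+ r ℤ.* u ℤ.+ (z ℤ.- r) ℤ.* (u ℤ.+ z ℤ.* q)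
  lemma = solve-∀

-- Products of linear factors and their Wronskian

prod : ∀ {k} → Vec ℤ k → ℤ → ℤ
prod []       z = 1ℤ
prod (x ∷ xs) z = (z ℤ.+ x) ℤ.* prod xs z

-- The derivative of prod, so that wronskian xs ys vanishes where the logarithmic
-- derivatives Σ 1/(z + x) and Σ 1/(z + y) agree.
prod′ : ∀ {k} → Vec ℤ k → ℤ → ℤ
prod′ []       z = 0ℤ
prod′ (x ∷ xs) z = prod xs z ℤ.+ (z ℤ.+ x) ℤ.* prod′ xs z

wronskian : ∀ {k l} → Vec ℤ k → Vec ℤ l → ℤ → ℤ
wronskian xs ys z = prod′ xs z ℤ.* prod ys z ℤ.- prod′ ys z ℤ.* prod xs z

-- The cofactor f is carried along, so that only multiplication by one linear factor at a time is
-- ever performed on coefficients.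
degree-prod-* : ∀ {k f n} (xs : Vec ℤ k) → f HasDegree< n → (λ z → prod xs z ℤ.* f z) HasDegree< k + n
degree-prod-* []       f<n = degree-cong (λ z → ℤ.*-identityˡ _) f<n
degree-prod-* (x ∷ xs) f<n = degree-cong (λ z → ℤ.*-assoc (z ℤ.+ x) _ _) (degree-linear x (degree-prod-* xs f<n))

degree-prod : ∀ {k} (xs : Vec ℤ k) → prod xs HasDegree< suc k
degree-prod {k} xs =
  subst (prod xs HasDegree<_) (ℕ.+-comm k 1)
    (degree-cong (λ z → sym (ℤ.*-identityʳ _)) (degree-prod-* xs (1ℤ ∷ [] , λ z → lemma z)))
  where
  lemma : ∀ z → 1ℤ ≡ 1ℤ ℤ.+ z ℤ.* 0ℤ
  lemma = solve-∀

degree-prod′-* : ∀ {k f n} (xs : Vec ℤ k) → f HasDegree< n → (λ z → prod′ xs z ℤ.* f z) HasDegree< k + n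
degree-prod′-* []               (c , _) = map (0ℤ ℤ.*_) c , λ z → sym (eval-map-* 0ℤ c z)
degree-prod′-* {f = f} (x ∷ xs) f<n =
  degree-cong (λ z → lemma (prod xs z) (z ℤ.+ x) (prod′ xs z) (f z))
    (degree-+ (degree-raise (degree-prod-* xs f<n)) (degree-linear x (degree-prod′-* xs f<n)))
  where
  lemma : ∀ a b c d → (a ℤ.+ b ℤ.* c) ℤ.* d ≡ a ℤ.* d ℤ.+ b ℤ.* (c ℤ.* d)
  lemma = solve-∀

-- A crude count, with `prod′` bounded like `prod` and cancellation of top terms ignored; it yields
-- the 2 k of `few-roots`.
degree-wronskian : ∀ {k} (xs ys : Vec ℤ k) → wronskian xs ys HasDegree< k + suc k
degree-wronskian xs ys =
  degree-cong (λ z → cong (λ v → prod′ xs z ℤ.* prod ys z ℤ.+ v) (sym (ℤ.-1*i≡-i _)))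
    (degree-+ (degree-prod′-* xs (degree-prod ys)) (degree-scale ℤ.-1ℤ (degree-prod′-* ys (degree-prod xs))))

-- Roots modulo p

module Roots (p : ℕ) .{{_ : NonZero p}} (p-prime : Prime p) where

  open PrimeField p p-prime
  open SetoidReasoning setoid

  -- Split off the first root; by primality the other roots are roots of the quotient. The
  -- conclusion concerns values instead of coefficients because the contradiction in
  -- `wronskian-roots` comes from a single value, the one at -x.
  eval-≈0 : ∀ {n} (c : Vec ℤ n) (r : Fin n → ℤ) → (∀ {i j} → r i ≈ r j → i ≡ j) →
            (∀ i → eval c (r i) ≈ 0ℤ) → ∀ z → eval c z ≈ 0ℤ
  eval-≈0 {zero}  []  r r-inj root z = ≈-refl
  eval-≈0 {suc n} c   r r-inj root z = begin
    eval c z                                   ≡⟨ factor-theorem r₀ c z ⟩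
    eval c r₀ ℤ.+ (z ℤ.- r₀) ℤ.* eval q z      ≈⟨ +-cong (root zero) (*-congˡ (z ℤ.- r₀) (q≈0 z)) ⟩
    0ℤ ℤ.+ (z ℤ.- r₀) ℤ.* 0ℤ                   ≡⟨ trans (ℤ.+-identityˡ _) (ℤ.*-zeroʳ (z ℤ.- r₀)) ⟩
    0ℤ                                         ∎
    where
    r₀ = r zero
    q  = synthetic-quotient r₀ c

    product≈0 : ∀ i → (r (suc i) ℤ.- r₀) ℤ.* eval q (r (suc i)) ≈ 0ℤ
    product≈0 i = begin
      (r (suc i) ℤ.- r₀) ℤ.* eval q (r (suc i))  ≡⟨ lemma (eval c r₀) _ ⟩
      (eval c r₀ ℤ.+ (r (suc i) ℤ.- r₀) ℤ.* eval q (r (suc i))) ℤ.- eval c r₀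
        ≡⟨ cong (ℤ._- eval c r₀) (factor-theorem r₀ c (r (suc i))) ⟨
      eval c (r (suc i)) ℤ.- eval c r₀           ≈⟨ -‿cong (root (suc i)) (root zero) ⟩
      0ℤ                                         ∎
      where
      lemma : ∀ u v → v ≡ (u ℤ.+ v) ℤ.- u
      lemma = solve-∀

    distinct : ∀ i → ¬ r (suc i) ℤ.- r₀ ≈ 0ℤ
    distinct i h with () ← r-inj (-≈0⇒≈ h)

    q≈0 : ∀ z → eval q z ≈ 0ℤ
    q≈0 = eval-≈0 q (λ i → r (suc i)) (λ h → Fin.suc-injective (r-inj h))
      (λ i → [ (λ h → contradiction h (distinct i)) , (λ h → h) ]′ (*≈0 _ _ (product≈0 i)))

  -- This makes -x a simple root of `prod xs` modulo p, so that the derivative does not vanish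
  -- there.
  data Once (x : ℤ) : ∀ {k} → Vec ℤ k → Set where
    head : ∀ {k y} {ys : Vec ℤ k} → y ≡ x → All (λ y → ¬ y ≈ x) ys → Once x (y ∷ ys)
    tail : ∀ {k y} {ys : Vec ℤ k} → ¬ y ≈ x → Once x ys → Once x (y ∷ ys)

  linear≉0 : ∀ {x y} → ¬ y ≈ x → ¬ ℤ.- x ℤ.+ y ≈ 0ℤ
  linear≉0 {x} {y} y≉x h = y≉x (-≈0⇒≈ (≈-trans (≈-reflexive (ℤ.+-comm y (ℤ.- x))) h))

  prod≉0 : ∀ {x k} {ys : Vec ℤ k} → All (λ y → ¬ y ≈ x) ys → ¬ prod ys (ℤ.- x) ≈ 0ℤ
  prod≉0 []          = 1≉0
  prod≉0 (y≉x ∷ ys) = *≉0 (linear≉0 y≉x) (prod≉0 ys)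

  Once⇒prod≡0 : ∀ {x k} {xs : Vec ℤ k} → Once x xs → prod xs (ℤ.- x) ≡ 0ℤ
  Once⇒prod≡0 {x} (head {ys = ys} refl _) =
    trans (cong (ℤ._* prod ys (ℤ.- x)) (ℤ.+-inverseˡ x)) (ℤ.*-zeroˡ (prod ys (ℤ.- x)))
  Once⇒prod≡0 {x} (tail {y = y} _ once)   =
    trans (cong ((ℤ.- x ℤ.+ y) ℤ.*_) (Once⇒prod≡0 once)) (ℤ.*-zeroʳ (ℤ.- x ℤ.+ y))

  Once⇒prod′≉0 : ∀ {x k} {xs : Vec ℤ k} → Once x xs → ¬ prod′ xs (ℤ.- x) ≈ 0ℤ
  Once⇒prod′≉0 {x} (head {ys = ys} refl ys≉x) h = prod≉0 ys≉x (≈-trans (≈-reflexive (sym eq)) h)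
    where
    eq : prod ys (ℤ.- x) ℤ.+ (ℤ.- x ℤ.+ x) ℤ.* prod′ ys (ℤ.- x) ≡ prod ys (ℤ.- x)
    eq = lemma (prod ys (ℤ.- x)) x (prod′ ys (ℤ.- x))
      where
      lemma : ∀ u x v → u ℤ.+ (ℤ.- x ℤ.+ x) ℤ.* v ≡ u
      lemma = solve-∀
  Once⇒prod′≉0 {x} (tail {y = y} {ys = ys} y≉x once) h =
    *≉0 (linear≉0 y≉x) (Once⇒prod′≉0 once)
      (≈-trans (≈-reflexive (sym (trans (cong (ℤ._+ v) (Once⇒prod≡0 once)) (ℤ.+-identityˡ v)))) h)
    where v = (ℤ.- x ℤ.+ y) ℤ.* prod′ ys (ℤ.- x)

  -- At -x the second term vanishes together with `prod xs`; the first is the derivative at a simple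
  -- root times a product of nonzero factors.
  wronskian≉0 : ∀ {x k l} {xs : Vec ℤ k} {ys : Vec ℤ l} → Once x xs → All (λ y → ¬ y ≈ x) ys →
                ¬ wronskian xs ys (ℤ.- x) ≈ 0ℤ
  wronskian≉0 {x} {xs = xs} {ys} once ys≉x h = *≉0 (Once⇒prod′≉0 once) (prod≉0 ys≉x) (≈-trans (≈-reflexive eq) h)
    where
    eq : prod′ xs (ℤ.- x) ℤ.* prod ys (ℤ.- x) ≡ wronskian xs ys (ℤ.- x)
    eq = sym (trans (cong (λ v → a ℤ.- prod′ ys (ℤ.- x) ℤ.* v) (Once⇒prod≡0 once)) (lemma a (prod′ ys (ℤ.- x))))
      where
      a = prod′ xs (ℤ.- x) ℤ.* prod ys (ℤ.- x)
      lemma : ∀ u v → u ℤ.- v ℤ.* 0ℤ ≡ u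
      lemma = solve-∀

  wronskian-roots : ∀ {x k} {xs ys : Vec ℤ k} → Once x xs → All (λ y → ¬ y ≈ x) ys →
                    (r : Fin (k + suc k) → ℤ) → (∀ {i j} → r i ≈ r j → i ≡ j) →
                    ¬ (∀ i → wronskian xs ys (r i) ≈ 0ℤ)
  wronskian-roots {x} {xs = xs} {ys} once ys≉x r r-inj root with degree-wronskian xs ys
  ... | c , w≡c = wronskian≉0 once ys≉x (≈-trans (≈-reflexive (w≡c (ℤ.- x)))
        (eval-≈0 c r r-inj (λ i → ≈-trans (≈-reflexive (sym (w≡c (r i)))) (root i)) (ℤ.- x)))

-- Pairs that represent the same fraction

module Fractions (p : ℕ) .{{_ : NonZero p}} (p-prime : Prime p) (A : ℤ) (Q′ U′ : ℕ)
                 (3Q′<p : 3 * Q′ < p) (3U′<p : 3 * U′ < p)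
                 (2QU≤p : 3 * Q′ * (3 * U′) + 3 * Q′ * (3 * U′) ≤ p) where

  open PrimeField p p-prime

  Q = 3 * Q′
  U = 3 * U′

  record Rep (z : ℤ) (q u : ℕ) : Set where
    constructor represents
    field
      0<q : 0 < q
      q≤Q : q ≤ Q
      u<U : u < U
      zq≈ : z ℤ.* + q ≈ A ℤ.+ + u

  rep? : ∀ z q → Dec (∃ (Rep z q))
  rep? z q with 0 ℕ.<? q | q ℕ.≤? Q | Fin.any? (λ (j : Fin U) → z ℤ.* + q ≈? A ℤ.+ + toℕ j)
  ... | no ¬0<q | _       | _             = no λ (u , rep) → ¬0<q (Rep.0<q rep)
  ... | yes _   | no ¬q≤Q | _             = no λ (u , rep) → ¬q≤Q (Rep.q≤Q rep)
  ... | yes 0<q | yes q≤Q | yes (j , eq) = yes (toℕ j , represents 0<q q≤Q (Fin.toℕ<n j) eq)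
  ... | yes _   | yes _   | no ¬j         = no λ (u , represents _ _ u<U eq) → ¬j (Fin.fromℕ< u<U ,
          subst (λ v → z ℤ.* + q ≈ A ℤ.+ + v) (sym (Fin.toℕ-fromℕ< u<U)) eq)

  rep-unique-u : ∀ {z q u v} → Rep z q u → Rep z q v → u ≡ v
  rep-unique-u {z} {q} {u} {v} (represents _ _ u<U eq) (represents _ _ v<U eq′) =
    +-≈-small (≈-trans (≈-trans (≈-reflexive (lemma A (+ u))) (-‿cong (≈-trans (≈-sym eq) eq′) (≈-refl {A})))
                       (≈-reflexive (sym (lemma A (+ v)))))
              (ℕ.<-trans u<U 3U′<p) (ℕ.<-trans v<U 3U′<p)
    where
    lemma : ∀ a u → u ≡ a ℤ.+ u ℤ.- a
    lemma = solve-∀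

  rep-unique-z : ∀ {z z′ q u} → Rep z q u → Rep z′ q u → z ≈ z′
  rep-unique-z {z} {z′} (represents 0<q q≤Q _ eq) (represents _ _ _ eq′) =
    *-cancelʳ z z′ (+≉0 0<q (ℕ.≤-<-trans q≤Q 3Q′<p)) (≈-trans eq (≈-sym eq′))

  Latest : ℤ → ℕ → Set
  Latest z n =
    (∃₂ λ q u → q ≤ n × Rep z q u × (∀ r v → q < r → r ≤ n → ¬ Rep z r v)) ⊎ (∀ r v → r ≤ n → ¬ Rep z r v)

  latest : ∀ z n → Latest z n
  latest z zero    = inj₂ λ r v r≤0 rep → ℕ.<⇒≱ (Rep.0<q rep) r≤0
  latest z (suc n) with rep? z (suc n) | latest z n
  ... | yes (u , rep) | _ = inj₁ (suc n , u , ℕ.≤-refl , rep , λ r v n<r r≤n _ → ℕ.<⇒≱ n<r r≤n)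
  ... | no ¬rep | inj₁ (q , u , q≤n , rep , none) = inj₁ (q , u , ℕ.m≤n⇒m≤1+n q≤n , rep , none′)
    where
    none′ : ∀ r v → q < r → r ≤ suc n → ¬ Rep z r v
    none′ r v q<r r≤1+n rep′ with ℕ.m≤n⇒m<n∨m≡n r≤1+n
    ... | inj₁ (s≤s r≤n) = none r v q<r r≤n rep′
    ... | inj₂ refl      = ¬rep (v , rep′)
  ... | no ¬rep | inj₂ none = inj₂ none′
    where
    none′ : ∀ r v → r ≤ suc n → ¬ Rep z r v
    none′ r v r≤1+n rep′ with ℕ.m≤n⇒m<n∨m≡n r≤1+n
    ... | inj₁ (s≤s r≤n) = none r v r≤n rep′
    ... | inj₂ refl      = ¬rep (v , rep′)

  -- A canonical pair for each z that has one, so that counting roots counts distinct fractions.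
  Root : ℤ → ℕ → ℕ → Set
  Root z q u = Rep z q u × (∀ r v → r < q → ¬ Rep z r v)

  root? : ∀ z q u → Rep z q u → Dec (Root z q u)
  root? z (suc m) u rep with latest z m
  ... | inj₁ (q , v , q≤m , rep′ , _) = no λ (_ , none) → none q v (s≤s q≤m) rep′
  ... | inj₂ none                     = yes (rep , λ { r v (s≤s r≤m) → none r v r≤m })

  root-unique : ∀ {z q u q′ u′} → Root z q u → Root z q′ u′ → q ≡ q′ × u ≡ u′
  root-unique {z} {q} {u} {q′} {u′} (rep , none) (rep′ , none′) with ℕ.<-cmp q q′
  ... | tri< q<q′ _ _ = contradiction rep (none′ q u q<q′)
  ... | tri> _ _ q′<q = contradiction rep′ (none q′ u′ q′<q)
  ... | tri≈ _ refl _ = refl , rep-unique-u rep rep′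

  -- The step vector is `(d , w)`; numerators may fall while denominators grow, hence w is an
  -- integer.
  Adjacent : ℤ → ℕ → ℤ → ℕ → ℕ → ℕ → ℕ → Set
  Adjacent z d w q u q′ u′ =
    Rep z q u × Rep z q′ u′ × 0 < d × q′ ≡ d + q × w ≡ + u′ ℤ.- + u × (∀ r v → q < r → r < q′ → ¬ Rep z r v)

  Gap : ℤ → ℕ → ℤ → Set
  Gap z d w = ∃₂ λ q u → ∃₂ λ q′ u′ → Adjacent z d w q u q′ u′

  gap-≈ : ∀ {z d w} → Gap z d w → z ℤ.* + d ≈ w
  gap-≈ {z} {d} (q , u , _ , u′ , represents _ _ _ eq , represents _ _ _ eq′ , _ , refl , refl , _) = begin
    z ℤ.* + d                                   ≡⟨ lemma z (+ d) (+ q) ⟩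
    z ℤ.* (+ d ℤ.+ + q) ℤ.- z ℤ.* + q           ≈⟨ -‿cong eq′ eq ⟩
    A ℤ.+ + u′ ℤ.- (A ℤ.+ + u)                  ≡⟨ lemma′ A (+ u′) (+ u) ⟩
    + u′ ℤ.- + u                                ∎
    where
    open SetoidReasoning setoid
    lemma : ∀ z d q → z ℤ.* d ≡ z ℤ.* (d ℤ.+ q) ℤ.- z ℤ.* q
    lemma = solve-∀
    lemma′ : ∀ a u v → a ℤ.+ u ℤ.- (a ℤ.+ v) ≡ u ℤ.- v
    lemma′ = solve-∀

  gap-small : ∀ {z d w} → Gap z d w → d ≤ Q × ℤ.∣ w ∣ < U
  gap-small {d = d} (q , u , _ , u′ , represents _ _ u<U _ , represents _ d+q≤Q u′<U _ , _ , refl , refl , _) =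
    ℕ.≤-trans (ℕ.m≤m+n d q) d+q≤Q , ∣m-n∣<b u′<U u<U

  -- Both sides are congruent to z d d′ and have absolute value below Q U, so `2QU≤p` leaves no room
  -- for a nonzero multiple of p between them.
  gap-collinear : ∀ {z d w d′ w′} → Gap z d w → Gap z d′ w′ → w ℤ.* + d′ ≡ w′ ℤ.* + d
  gap-collinear {z} {d} {w} {d′} {w′} gap gap′ = ≈-small congruent small
    where
    open SetoidReasoning setoid
    lemma : ∀ z d d′ → z ℤ.* d ℤ.* d′ ≡ z ℤ.* d′ ℤ.* d
    lemma = solve-∀
    congruent : w ℤ.* + d′ ≈ w′ ℤ.* + d
    congruent = begin
      w ℤ.* + d′            ≈⟨ *-congʳ (+ d′) (gap-≈ gap) ⟨
      z ℤ.* + d ℤ.* + d′    ≡⟨ lemma z (+ d) (+ d′) ⟩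
      z ℤ.* + d′ ℤ.* + d    ≈⟨ *-congʳ (+ d) (gap-≈ gap′) ⟩
      w′ ℤ.* + d            ∎
    bound : ∀ {d w d′ w′} → Gap z d w → Gap z d′ w′ → ℤ.∣ w ℤ.* + d′ ∣ < Q * U
    bound {d} {w} {d′} {w′} gap@(_ , _ , _ , _ , represents 0<q q≤Q _ _ , _) gap′ = ℕ.<-≤-trans
      (ℕ.≤-<-trans (ℕ.≤-reflexive (ℤ.abs-* w (+ d′)))
        (ℕ.≤-<-trans (ℕ.*-monoʳ-≤ ℤ.∣ w ∣ (proj₁ (gap-small gap′)))
          (ℕ.*-monoˡ-< Q {{ℕ.>-nonZero (ℕ.<-≤-trans 0<q q≤Q)}} (proj₂ (gap-small gap)))))
      (ℕ.≤-reflexive (ℕ.*-comm U Q))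
    small : ℤ.∣ w ℤ.* + d′ ℤ.- w′ ℤ.* + d ∣ < p
    small = ℕ.<-≤-trans
      (ℕ.≤-<-trans (ℤ.∣i-j∣≤∣i∣+∣j∣ (w ℤ.* + d′) (w′ ℤ.* + d))
        (ℕ.+-mono-< (bound {d} {w} {d′} {w′} gap gap′) (bound {d′} {w′} {d} {w} gap′ gap)))
      2QU≤p

  -- Cleared of denominators, x is the mean of a and b with weights d and e, hence it stays in the
  -- range of numerators.
  convex : ∀ x d e {a b} → 0 < d → + (d + e) ℤ.* x ≡ + d ℤ.* + a ℤ.+ + e ℤ.* + b →
           a < U → b < U → ∃ λ n → x ≡ + n × n < U
  convex x d@(suc _) e {a} {b} 0<d eq a<U b<U = helper x (trans eq pos)
    where
    pos : + d ℤ.* + a ℤ.+ + e ℤ.* + b ≡ + (d * a + e * b)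
    pos = trans (cong₂ ℤ._+_ (sym (ℤ.pos-* d a)) (sym (ℤ.pos-* e b))) (sym (ℤ.pos-+ (d * a) (e * b)))
    below : d * a + e * b < (d + e) * U
    below = ℕ.<-≤-trans (ℕ.+-mono-<-≤ (ℕ.*-monoʳ-< d a<U) (ℕ.*-monoʳ-≤ e (ℕ.<⇒≤ b<U)))
              (ℕ.≤-reflexive (sym (ℕ.*-distribʳ-+ U d e)))
    helper : ∀ x → + (d + e) ℤ.* x ≡ + (d * a + e * b) → ∃ λ n → x ≡ + n × n < U
    helper (+ n) h = n , refl , ℕ.*-cancelˡ-< (d + e) n U
      (subst (_< (d + e) * U) (sym (ℤ.+-injective (trans (ℤ.pos-* (d + e) n) h))) below)
    helper ℤ.-[1+ n ] ()

  -- If d < d′, then stepping back by d from the upper end of the gap d′ gives a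
  -- representation inside that gap: collinearity makes it a convex combination of
  -- the two ends.
  gap-≮ : ∀ {z d w d′ w′} → Gap z d w → Gap z d′ w′ → ¬ d < d′
  gap-≮ {z} {d} {w} {d′} {w′} gap@(_ , _ , _ , _ , _ , _ , 0<d , _)
        gap′@(q , u , _ , u′ , represents 0<q q≤Q u<U eq , represents 0<q′ q′≤Q u′<U eq′ , 0<d′ , refl , refl , none) d<d′ =
    let e , d′≡d+e = ℕ.m≤n⇒∃[o]m+o≡n (ℕ.<⇒≤ d<d′)
        n , x≡n , n<U = convex (+ u′ ℤ.- w) d e 0<d (combination e d′≡d+e) u<U u′<U
    in none (e + q) n (inside₁ e d′≡d+e) (inside₂ e d′≡d+e)
         (represents
           (ℕ.<-≤-trans 0<q (ℕ.m≤n+m q e))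
           (ℕ.≤-trans (ℕ.<⇒≤ (inside₂ e d′≡d+e)) q′≤Q)
           n<U
           (≈-trans (relation e d′≡d+e) (≈-reflexive (cong (λ v → A ℤ.+ v) x≡n))))
    where
    open SetoidReasoning setoid
    inside₁ : ∀ e → d + e ≡ d′ → q < e + q
    inside₁ zero    eq = contradiction (trans (sym (ℕ.+-identityʳ d)) eq) (ℕ.<⇒≢ d<d′)
    inside₁ (suc e) eq = s≤s (ℕ.m≤n+m q e)
    inside₂ : ∀ e → d + e ≡ d′ → e + q < d′ + q
    inside₂ e refl = ℕ.+-monoˡ-< q (ℕ.m<n+m e 0<d)
    combination : ∀ e → d + e ≡ d′ → + (d + e) ℤ.* (+ u′ ℤ.- w) ≡ + d ℤ.* + u ℤ.+ + e ℤ.* + u′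
    combination e refl = trans (lemma (+ d) (+ e) (+ u′) w)
      (trans (cong (λ v → + d ℤ.* + u′ ℤ.+ + e ℤ.* + u′ ℤ.- v) (gap-collinear gap gap′)) (lemma′ (+ d) (+ e) (+ u) (+ u′)))
      where
      lemma : ∀ d e v w → (d ℤ.+ e) ℤ.* (v ℤ.- w) ≡ d ℤ.* v ℤ.+ e ℤ.* v ℤ.- w ℤ.* (d ℤ.+ e)
      lemma = solve-∀
      lemma′ : ∀ d e u v → d ℤ.* v ℤ.+ e ℤ.* v ℤ.- (v ℤ.- u) ℤ.* d ≡ d ℤ.* u ℤ.+ e ℤ.* v
      lemma′ = solve-∀
    relation : ∀ e → d + e ≡ d′ → z ℤ.* + (e + q) ≈ A ℤ.+ (+ u′ ℤ.- w)
    relation e refl = begin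
      z ℤ.* + (e + q)                                    ≡⟨ lemma z (+ d) (+ e) (+ q) ⟩
      z ℤ.* + (d + e + q) ℤ.- z ℤ.* + d                  ≈⟨ -‿cong eq′ (gap-≈ gap) ⟩
      A ℤ.+ + u′ ℤ.- w                                   ≡⟨ ℤ.+-assoc A (+ u′) (ℤ.- w) ⟩
      A ℤ.+ (+ u′ ℤ.- w)                                 ∎
      where
      lemma : ∀ z d e q → z ℤ.* (e ℤ.+ q) ≡ z ℤ.* (d ℤ.+ e ℤ.+ q) ℤ.- z ℤ.* d
      lemma = solve-∀

  -- `gap-≮` in both directions gives d, and collinearity gives w after cancelling d. One step
  -- vector thus serves all consecutive pairs of z.
  gap-unique : ∀ {z d w d′ w′} → Gap z d w → Gap z d′ w′ → d ≡ d′ × w ≡ w′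
  gap-unique {z} {d} {w} {d′} {w′} gap@(_ , _ , _ , _ , _ , _ , 0<d , _) gap′ with ℕ.<-cmp d d′
  ... | tri< d<d′ _ _ = contradiction d<d′ (gap-≮ gap gap′)
  ... | tri> _ _ d′<d = contradiction d′<d (gap-≮ gap′ gap)
  ... | tri≈ _ refl _ = refl , ℤ.*-cancelʳ-≡ w w′ (+ d) {{ℕ.>-nonZero 0<d}} (gap-collinear gap gap′)

  -- `Chain z q u i q₀ u₀` places `(q , u)` exactly i steps beyond the root `(q₀ , u₀)` of z.
  data Chain (z : ℤ) : ℕ → ℕ → ℕ → ℕ → ℕ → Set where
    root : ∀ {q u} → Root z q u → Chain z q u 0 q u
    next : ∀ {d w q u q′ u′ i q₀ u₀} → Adjacent z d w q u q′ u′ → Chain z q u i q₀ u₀ → Chain z q′ u′ (suc i) q₀ u₀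

  chain : ∀ {z} q u → Rep z q u → ∃ λ i → ∃₂ λ q₀ u₀ → Chain z q u i q₀ u₀
  chain {z} = <-rec _ step
    where
    step : ∀ q → (∀ {r} → r < q → ∀ u → Rep z r u → ∃ λ i → ∃₂ λ q₀ u₀ → Chain z r u i q₀ u₀) →
           ∀ u → Rep z q u → ∃ λ i → ∃₂ λ q₀ u₀ → Chain z q u i q₀ u₀
    step (suc m) rec u rep with latest z m
    ... | inj₂ none = 0 , suc m , u , root (rep , λ { r v (s≤s r≤m) → none r v r≤m })
    ... | inj₁ (q , v , q≤m , rep′ , none) with rec (s≤s q≤m) v rep′
    ...   | i , q₀ , u₀ , c = suc i , q₀ , u₀ ,
            next (rep′ , rep , ℕ.m<n⇒0<n∸m (s≤s q≤m) , sym (ℕ.m∸n+n≡m (ℕ.m≤n⇒m≤1+n q≤m)) , refl ,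
                  λ { r v q<r (s≤s r≤m) → none r v q<r r≤m }) c

  chain-root : ∀ {z q u i q₀ u₀} → Chain z q u i q₀ u₀ → Root z q₀ u₀
  chain-root (root r)   = r
  chain-root (next _ c) = chain-root c

  -- The gap is a separate argument because a chain of length 0 contains none; by `gap-unique` every
  -- step of the chain equals it.
  chain-linear : ∀ {z q u i q₀ u₀ d w} → Chain z q u i q₀ u₀ → Gap z d w →
                 q ≡ i * d + q₀ × + u ≡ + i ℤ.* w ℤ.+ + u₀
  chain-linear {u = u} {w = w} (root _) _ = refl , sym (trans (cong (ℤ._+ + u) (ℤ.*-zeroˡ w)) (ℤ.+-identityˡ (+ u)))
  chain-linear {u₀ = u₀} {d} {w} (next {u = v} {u′ = v′} {i = i} adj@(_ , _ , _ , refl , refl , _) c) gap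
    with refl , refl ← gap-unique (_ , _ , _ , _ , adj) gap
    with refl , v≡ ← chain-linear c gap =
      sym (ℕ.+-assoc d (i * d) _) ,
      trans (lemma (+ v′) (+ v)) (trans (cong (λ x → w ℤ.+ x) v≡) (lemma′ w (+ i) (+ u₀)))
    where
    lemma : ∀ v′ v → v′ ≡ v′ ℤ.- v ℤ.+ v
    lemma = solve-∀
    lemma′ : ∀ w i u → w ℤ.+ (i ℤ.* w ℤ.+ u) ≡ (ℤ.1ℤ ℤ.+ i) ℤ.* w ℤ.+ u
    lemma′ = solve-∀

  chain-end-unique : ∀ {z q u q′ u′ i q₀ u₀} → Chain z q u i q₀ u₀ → Chain z q′ u′ i q₀ u₀ → q ≡ q′ × u ≡ u′
  chain-end-unique (root _)       (root _) = refl , refl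
  chain-end-unique (next adj c) c′         =
    let gap = _ , _ , _ , _ , adj
        q≡ , u≡ = chain-linear (next adj c) gap
        q′≡ , u′≡ = chain-linear c′ gap
    in trans q≡ (sym q′≡) , ℤ.+-injective (trans u≡ (sym u′≡))

  chain-gap : ∀ {z q u i q₀ u₀} → 0 < i → Chain z q u i q₀ u₀ → ∃₂ (Gap z)
  chain-gap _ (next adj _) = _ , _ , _ , _ , _ , _ , adj

  chain-determined : ∀ {z q u q′ u′ i q₀ u₀ q₁ u₁} → Chain z q u i q₀ u₀ → Chain z q′ u′ i q₁ u₁ → q ≡ q′ × u ≡ u′
  chain-determined c c′ with refl , refl ← root-unique (chain-root c) (chain-root c′) = chain-end-unique c c′

  -- For a fixed z the step length d is determined, so t d determines t and with it the position j +
  -- 3 t in the progression.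
  long-chain-determined : ∀ {z q u q′ u′ q₀ u₀ q₁ u₁ d w d′ w′} j t t′ →
    Chain z q u (j + t * 3) q₀ u₀ → Chain z q′ u′ (j + t′ * 3) q₁ u₁ → Gap z d w → Gap z d′ w′ →
    t * d ≡ t′ * d′ → q ≡ q′ × u ≡ u′
  long-chain-determined {d = d} j t t′ c c′ gap@(_ , _ , _ , _ , _ , _ , 0<d , _) gap′ td≡
    with refl , refl ← gap-unique gap gap′
    with refl ← ℕ.*-cancelʳ-≡ t t′ d {{ℕ.>-nonZero 0<d}} td≡ = chain-determined c c′

-- Counting distinct fractions

shift : ∀ {n} x → ℤ.∣ x ∣ < n → ∃ λ (i : Fin (n + n)) → + toℕ i ≡ x ℤ.+ + n
shift {n} x x<n = Fin.fromℕ< bound , trans (cong +_ (Fin.toℕ-fromℕ< bound)) (ℤ.0≤i⇒+∣i∣≡i (nonneg x x<n))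
  where
  bound : ℤ.∣ x ℤ.+ + n ∣ < n + n
  bound = ℕ.≤-<-trans (ℤ.∣i+j∣≤∣i∣+∣j∣ x (+ n)) (ℕ.+-monoˡ-< n x<n)
  nonneg : ∀ x → ℤ.∣ x ∣ < n → 0ℤ ℤ.≤ x ℤ.+ + n
  nonneg (+ m)      _   = ℤ.+≤+ z≤n
  nonneg ℤ.-[1+ m ] m<n = subst (0ℤ ℤ.≤_) (sym (ℤ.⊖-≥ (ℕ.<⇒≤ m<n))) (ℤ.+≤+ z≤n)

module FractionCount (p : ℕ) .{{_ : NonZero p}} (p-prime : Prime p) (A : ℤ) (Q′ U′ : ℕ)
                     (3Q′<p : 3 * Q′ < p) (3U′<p : 3 * U′ < p)
                     (2QU≤p : 3 * Q′ * (3 * U′) + 3 * Q′ * (3 * U′) ≤ p) where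

  open PrimeField p p-prime
  open Fractions p p-prime A Q′ U′ 3Q′<p 3U′<p 2QU≤p

  -- Denominators run over 1, ..., Q, hence the successor; numerator offsets run over 0, ..., U - 1.
  q-of u-of : Fin (Q * U) → ℕ
  q-of x = suc (toℕ (quotient {Q} U x))
  u-of x = toℕ (remainder {Q} U x)

  abstract

    -- Reduced modulo p, so that congruent fractions are equal integers and statements about one z
    -- can be transported to the other.
    z-of : Fin (Q * U) → ℤ
    z-of x = + (((A ℤ.+ + u-of x) ℤ.* inv (+ q-of x)) ℤ.%ℕ p)

    q-of≤Q : ∀ x → q-of x ≤ Q
    q-of≤Q x = Fin.toℕ<n (quotient {Q} U x)

    rep-of : ∀ x → Rep (z-of x) (q-of x) (u-of x)
    rep-of x = represents (s≤s z≤n) (q-of≤Q x) (Fin.toℕ<n (remainder {Q} U x)) (begin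
      z-of x ℤ.* + q-of x                          ≈⟨ *-congʳ (+ q-of x) (%-≈ (y ℤ.* inv (+ q-of x))) ⟩
      y ℤ.* inv (+ q-of x) ℤ.* + q-of x            ≡⟨ lemma y (inv (+ q-of x)) (+ q-of x) ⟩
      y ℤ.* (+ q-of x ℤ.* inv (+ q-of x))          ≈⟨ *-congˡ y (*-inv (+ q-of x) q≉0) ⟩
      y ℤ.* 1ℤ                                     ≡⟨ ℤ.*-identityʳ y ⟩
      y                                            ∎)
      where
      open SetoidReasoning setoid
      q≉0 : ¬ + q-of x ≈ 0ℤ
      q≉0 = +≉0 (s≤s z≤n) (ℕ.≤-<-trans (q-of≤Q x) 3Q′<p)
      y : ℤ
      y = A ℤ.+ + u-of x
      lemma : ∀ a b c → a ℤ.* b ℤ.* c ≡ a ℤ.* (c ℤ.* b)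
      lemma = solve-∀

    z-of-injective : ∀ x y → z-of x ≈ z-of y → z-of x ≡ z-of y
    z-of-injective x y′ h = cong +_ (+-≈-small h (ℤ.n%ℕd<d (y x) p) (ℤ.n%ℕd<d (y y′) p))
      where
      y : Fin (Q * U) → ℤ
      y x = (A ℤ.+ + u-of x) ℤ.* inv (+ q-of x)

  coordinates-injective : ∀ x y → q-of x ≡ q-of y → u-of x ≡ u-of y → x ≡ y
  coordinates-injective x y q≡ u≡ = begin
    x                                                  ≡⟨ Fin.combine-remQuot {Q} U x ⟨
    combine (quotient {Q} U x) (remainder {Q} U x)
      ≡⟨ cong₂ combine (Fin.toℕ-injective (ℕ.suc-injective q≡)) (Fin.toℕ-injective u≡) ⟩
    combine (quotient {Q} U y) (remainder {Q} U y)     ≡⟨ Fin.combine-remQuot {Q} U y ⟩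
    y                                                  ∎
    where open ≡-Reasoning

  point : ∀ {z q u} → Rep z q u → ∃ λ x → q-of x ≡ q × u-of x ≡ u
  point {q = suc q} {u} (represents _ q<Q u<U _) = combine i j ,
    cong suc (trans (cong (λ v → toℕ (proj₁ v)) (Fin.remQuot-combine i j)) (Fin.toℕ-fromℕ< q<Q)) ,
    trans (cong (λ v → toℕ (proj₂ v)) (Fin.remQuot-combine i j)) (Fin.toℕ-fromℕ< u<U)
    where
    i = Fin.fromℕ< q<Q
    j = Fin.fromℕ< u<U

  IsRoot : Fin (Q * U) → Set
  IsRoot x = Root (z-of x) (q-of x) (u-of x)

  isRoot? : Decidable IsRoot
  isRoot? x = root? (z-of x) (q-of x) (u-of x) (rep-of x)

  roots : Subset (Q * U)
  roots = comprehension isRoot?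

  roots-distinct : ∀ {x y} → IsRoot x → IsRoot y → z-of x ≈ z-of y → x ≡ y
  roots-distinct {x} {y} rx ry h =
    let q≡ , u≡ = root-unique rx (subst (λ z → Root z (q-of y) (u-of y)) (sym (z-of-injective x y h)) ry)
    in coordinates-injective x y q≡ u≡

  -- A point x with chain of length i < 3 is coded by its root and i; otherwise
  -- i = 3 t + j with t > 0 and x is coded by j and by t times the gap vector, which
  -- lies in a box with sides a third of the original ones.
  Code : Set
  Code = (Fin ∣ roots ∣ ⊎ Fin Q′ × Fin (U′ + U′)) × Fin 3

  Codes : Fin (Q * U) → Code → Set
  Codes x (inj₁ g , j) =
    Chain (z-of x) (q-of x) (u-of x) (toℕ j) (q-of (element roots g)) (u-of (element roots g))
  Codes x (inj₂ (a , b) , j) = ∃₂ λ t d → ∃ λ w → ∃₂ λ q₀ u₀ →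
    Chain (z-of x) (q-of x) (u-of x) (toℕ j + t * 3) q₀ u₀ × Gap (z-of x) d w ×
    0 < t * d × toℕ a ≡ t * d × + toℕ b ≡ + t ℤ.* w ℤ.+ + U′

  -- In both cases the code recovers z, and then the position in the progression of z. A short code
  -- names the root, which is a pair of z. A long one gives z (t d) ≡ t w, which can be solved for z
  -- since 0 < t d < p.
  Codes-injective : ∀ {x y} c → Codes x c → Codes y c → x ≡ y
  Codes-injective {x} {y} (inj₁ g , j) cx cy =
    let rep , _  = chain-root cx
        rep′ , _ = chain-root cy
        z≡       = z-of-injective x y (rep-unique-z rep rep′)
        q≡ , u≡  = chain-determined cx (subst (λ z → Chain z _ _ _ _ _) (sym z≡) cy)
    in coordinates-injective x y q≡ u≡
  Codes-injective {x} {y} (inj₂ (a , b) , j) (t , d , w , _ , _ , cx , gap , 0<td , a≡ , b≡)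
                                             (t′ , d′ , w′ , _ , _ , cy , gap′ , 0<t′d′ , a≡′ , b≡′) =
    same-z (z-of-injective x y (*-cancelʳ (z-of x) (z-of y) a≉0
      (≈-trans (za≈ {t} gap a≡ b≡) (≈-sym (za≈ {t′} gap′ a≡′ b≡′)))))
    where
    open SetoidReasoning setoid
    a≉0 : ¬ + toℕ a ≈ 0ℤ
    a≉0 = +≉0 (subst (0 <_) (sym a≡) 0<td)
      (ℕ.<-trans (Fin.toℕ<n a) (ℕ.≤-<-trans (ℕ.m≤m+n Q′ _) 3Q′<p))
    za≈ : ∀ {t d w z} → Gap z d w → toℕ a ≡ t * d → + toℕ b ≡ + t ℤ.* w ℤ.+ + U′ →
          z ℤ.* + toℕ a ≈ + toℕ b ℤ.- + U′
    za≈ {t} {d} {w} {z} gap a≡ b≡ = begin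
      z ℤ.* + toℕ a                    ≡⟨ cong (λ v → z ℤ.* v) (trans (cong +_ a≡) (ℤ.pos-* t d)) ⟩
      z ℤ.* (+ t ℤ.* + d)              ≡⟨ lemma z (+ t) (+ d) ⟩
      + t ℤ.* (z ℤ.* + d)              ≈⟨ *-congˡ (+ t) (gap-≈ gap) ⟩
      + t ℤ.* w                        ≡⟨ lemma′ (+ t ℤ.* w) (+ U′) ⟩
      + t ℤ.* w ℤ.+ + U′ ℤ.- + U′      ≡⟨ cong (λ v → v ℤ.- + U′) b≡ ⟨
      + toℕ b ℤ.- + U′                 ∎
      where
      lemma : ∀ z t d → z ℤ.* (t ℤ.* d) ≡ t ℤ.* (z ℤ.* d)
      lemma = solve-∀
      lemma′ : ∀ v u → v ≡ v ℤ.+ u ℤ.- u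
      lemma′ = solve-∀
    same-z : z-of x ≡ z-of y → x ≡ y
    same-z z≡ =
      let q≡ , u≡ = long-chain-determined (toℕ j) t t′ cx (subst (λ z → Chain z _ _ _ _ _) (sym z≡) cy)
                      gap (subst (λ z → Gap z d′ w′) (sym z≡) gap′) (trans (sym a≡) a≡′)
      in coordinates-injective x y q≡ u≡

  code : ∀ x → ∃ (Codes x)
  code x with chain (q-of x) (u-of x) (rep-of x)
  ... | i , q₀ , u₀ , c with i ℕ.divMod 3
  ...   | ℕ.result zero j refl = (inj₁ (index roots y∈) , j) ,
          subst (λ y → Chain (z-of x) (q-of x) (u-of x) (toℕ j) (q-of y) (u-of y)) (sym (element-index roots y∈))
            (subst₂ (Chain _ _ _ _) (sym q≡) (sym u≡) (subst (λ i → Chain _ _ _ i _ _) (ℕ.+-identityʳ (toℕ j)) c))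
    where
    root₀ = chain-root c
    y = proj₁ (point (proj₁ root₀))
    q≡ = proj₁ (proj₂ (point (proj₁ root₀)))
    u≡ = proj₂ (proj₂ (point (proj₁ root₀)))
    rep₀ : Rep (z-of x) (q-of y) (u-of y)
    rep₀ = subst₂ (Rep (z-of x)) (sym q≡) (sym u≡) (proj₁ root₀)
    y∈ : y ∈ roots
    y∈ = ∈-comprehension⁺ isRoot?
      (subst₂ (λ z q → Root z q (u-of y)) (z-of-injective x y (rep-unique-z rep₀ (rep-of y))) (sym q≡)
        (subst (Root (z-of x) q₀) (sym u≡) root₀))
  ...   | ℕ.result (suc t) j refl
          with _ , _ , gap@(_ , _ , _ , _ , _ , _ , 0<d , _) ←
               chain-gap (ℕ.<-≤-trans (s≤s z≤n) (ℕ.m≤n+m (suc t * 3) (toℕ j))) c =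
          long-code gap 0<d
    where
    i′ = toℕ j + suc t * 3
    long-code : ∀ {d w} → Gap (z-of x) d w → 0 < d → ∃ (Codes x)
    long-code {d} {w} gap 0<d =
      let b , b≡ = shift (+ suc t ℤ.* w) w-bound
      in (inj₂ (Fin.fromℕ< d-bound , b) , j) , suc t , d , w , q₀ , u₀ , c , gap ,
         ℕ.<-≤-trans 0<d (ℕ.m≤m+n d (t * d)) , Fin.toℕ-fromℕ< d-bound , b≡
      where
      linear = chain-linear c gap
      0<q₀ = Rep.0<q (proj₁ (chain-root c))
      u₀<U = Rep.u<U (proj₁ (chain-root c))
      -- Since 3 (t + 1) ≤ i′, three times the coded vector is in absolute value at most i′ (d , w),
      -- a difference of two points of the box with sides 3 Q′ and 3 U′. Division by 3 bounds its
      -- coordinates by Q′ and U′.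
      triple : ∀ m → 3 * (suc t * m) ≤ i′ * m
      triple m = ℕ.≤-trans
        (ℕ.≤-reflexive (trans (sym (ℕ.*-assoc 3 (suc t) m)) (cong (_* m) (ℕ.*-comm 3 (suc t)))))
        (ℕ.*-monoˡ-≤ m (ℕ.m≤n+m (suc t * 3) (toℕ j)))
      d-bound : suc t * d < Q′
      d-bound = ℕ.*-cancelˡ-< 3 (suc t * d) Q′ (ℕ.≤-<-trans (triple d) (ℕ.<-≤-trans
        (ℕ.m<m+n (i′ * d) 0<q₀) (ℕ.≤-trans (ℕ.≤-reflexive (sym (proj₁ linear))) (q-of≤Q x))))
      iw≡ : + i′ ℤ.* w ≡ + u-of x ℤ.- + u₀
      iw≡ = trans (lemma (+ i′ ℤ.* w) (+ u₀)) (cong (ℤ._- + u₀) (sym (proj₂ linear)))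
        where
        lemma : ∀ a b → a ≡ a ℤ.+ b ℤ.- b
        lemma = solve-∀
      w-bound : ℤ.∣ + suc t ℤ.* w ∣ < U′
      w-bound = subst (_< U′) (sym (ℤ.abs-* (+ suc t) w)) (ℕ.*-cancelˡ-< 3 _ U′
        (ℕ.≤-<-trans (triple ℤ.∣ w ∣) (subst (_< U) (trans (cong ℤ.∣_∣ (sym iw≡)) (ℤ.abs-* (+ i′) w))
          (∣m-n∣<b (Rep.u<U (rep-of x)) u₀<U))))

  encode : Code → Fin ((∣ roots ∣ + Q′ * (U′ + U′)) * 3)
  encode (c , j) = combine (join ∣ roots ∣ (Q′ * (U′ + U′)) (Sum.map₂ (uncurry combine) c)) j

  encode-injective : ∀ {c c′} → encode c ≡ encode c′ → c ≡ c′
  encode-injective {c , j} {c′ , j′} eq =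
    let join≡ , j≡ = Fin.combine-injective _ j _ j′ eq
    in cong₂ _,_ (sum-injective c c′ (join-injective ∣ roots ∣ _ join≡)) j≡
    where
    sum-injective : ∀ (c c′ : Fin ∣ roots ∣ ⊎ Fin Q′ × Fin (U′ + U′)) →
                    Sum.map₂ (uncurry combine) c ≡ Sum.map₂ (uncurry combine) c′ → c ≡ c′
    sum-injective (inj₁ g)       (inj₁ g)         refl = refl
    sum-injective (inj₂ (a , b)) (inj₂ (a′ , b′)) eq   =
      let a≡ , b≡ = Fin.combine-injective a b a′ b′ (Sum.inj₂-injective eq) in cong inj₂ (cong₂ _,_ a≡ b≡)

  -- The 9 Q′ U′ points inject into 3 (|roots| + 2 Q′ U′) codes. With m in place of 3 the same count
  -- leaves (m - 2) Q′ U′ roots, so 3 is the least usable factor.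
  roots-many : Q′ * U′ ≤ ∣ roots ∣
  roots-many = ℕ.+-cancelʳ-≤ (Q′ * (U′ + U′)) _ _ (ℕ.*-cancelʳ-≤ _ _ 3
    (subst (_≤ (∣ roots ∣ + Q′ * (U′ + U′)) * 3) (lemma Q′ U′) count))
    where
    count : Q * U ≤ (∣ roots ∣ + Q′ * (U′ + U′)) * 3
    count = Fin.injective⇒≤ {f = λ x → encode (proj₁ (code x))} λ {x} {y} eq →
      Codes-injective (proj₁ (code x)) (proj₂ (code x)) (subst (Codes y) (sym (encode-injective eq)) (proj₂ (code y)))
    lemma : ∀ a b → 3 * a * (3 * b) ≡ (a * b + a * (b + b)) * 3
    lemma = ℕ.solve-∀

-- Images of maps with few collisions

Collides : ∀ {T n} → (Fin T → Fin n) → Pred (Fin (T * T)) 0ℓ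
Collides {T} f x = let i , j = remQuot {T} T x in j Fin.< i × f j ≡ f i

collides? : ∀ {T n} (f : Fin T → Fin n) → Decidable (Collides f)
collides? {T} f x = let i , j = remQuot {T} T x in (j Fin.<? i) ×-dec (f j Fin.≟ f i)

collisions : ∀ {T n} → (Fin T → Fin n) → Subset (T * T)
collisions f = comprehension (collides? f)

collision⁺ : ∀ {T n} (f : Fin T → Fin n) {i j} → j Fin.< i → f j ≡ f i → combine i j ∈ collisions f
collision⁺ f {i} {j} j<i eq = ∈-comprehension⁺ (collides? f)
  (subst₂ (λ i j → j Fin.< i × f j ≡ f i) (sym (cong proj₁ (Fin.remQuot-combine i j)))
    (sym (cong proj₂ (Fin.remQuot-combine i j))) (j<i , eq))

-- An argument t whose value already occurs at some j < t is charged to the collision (t , j); the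
-- others have distinct values in S.
image-size : ∀ {T n} (f : Fin T → Fin n) (S : Subset n) → (∀ t → f t ∈ S) → T ≤ ∣ S ∣ + ∣ collisions f ∣
image-size {T} f S f∈S = Fin.injective⇒≤ {f = λ t → join ∣ S ∣ _ (code t)} λ {t} {t′} eq →
  code-injective t t′ (join-injective ∣ S ∣ _ eq)
  where
  earlier? : ∀ t → Dec (∃ λ j → j Fin.< t × f j ≡ f t)
  earlier? t = Fin.any? λ j → (j Fin.<? t) ×-dec (f j Fin.≟ f t)
  code : Fin T → Fin ∣ S ∣ ⊎ Fin ∣ collisions f ∣
  code t with earlier? t
  ... | yes (j , j<t , eq) = inj₂ (index (collisions f) (collision⁺ f j<t eq))
  ... | no _               = inj₁ (index S (f∈S t))
  code-injective : ∀ t t′ → code t ≡ code t′ → t ≡ t′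
  code-injective t t′ eq with earlier? t | earlier? t′
  ... | yes (j , j<t , e) | yes (j′ , j′<t′ , e′) =
        Fin.combine-injectiveˡ t j t′ j′
          (index-injective (collisions f) (collision⁺ f j<t e) (collision⁺ f j′<t′ e′) (Sum.inj₂-injective eq))
  ... | yes _ | no _ = contradiction eq λ ()
  ... | no _ | yes _ = contradiction eq λ ()
  ... | no ¬t | no ¬t′ with Fin.<-cmp t t′ | index-injective S (f∈S t) (f∈S t′) (Sum.inj₁-injective eq)
  ...   | tri< t<t′ _ _ | ft≡ = contradiction (t , t<t′ , ft≡) ¬t′
  ...   | tri≈ _ t≡t′ _ | _   = t≡t′
  ...   | tri> _ _ t′<t | ft≡ = contradiction (t′ , t′<t , sym ft≡) ¬t

-- The incidences x ∈ C g are counted by g from below and by x from above.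
double-count : ∀ {γ m K ρ} (C : Fin γ → Subset m) → (∀ g → K ≤ ∣ C g ∣) →
               (∀ x → ∣ comprehension (λ g → x ∈? C g) ∣ ≤ ρ) → γ * K ≤ m * ρ
double-count {γ} {m} {K} {ρ} C K≤ ≤ρ = Fin.injective⇒≤ {f = λ y → code (remQuot {γ} K y)} λ {y} {y′} eq →
  trans (sym (Fin.combine-remQuot {γ} K y))
    (trans (cong (uncurry combine) (code-injective (remQuot {γ} K y) (remQuot {γ} K y′) eq))
      (Fin.combine-remQuot {γ} K y′))
  where
  R : Fin m → Subset γ
  R x = comprehension (λ g → x ∈? C g)
  point : Fin γ × Fin K → Fin m
  point (g , j) = element (C g) (Fin.inject≤ j (K≤ g))
  g∈R : ∀ y → proj₁ y ∈ R (point y)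
  g∈R y@(g , j) = ∈-comprehension⁺ (λ h → point y ∈? C h) (element-∈ (C g) (Fin.inject≤ j (K≤ g)))
  rank : ∀ x {g} → g ∈ R x → Fin ρ
  rank x g∈ = Fin.inject≤ (index (R x) g∈) (≤ρ x)
  rank-injective : ∀ {x x′ g g′} (h : g ∈ R x) (h′ : g′ ∈ R x′) → x ≡ x′ → rank x h ≡ rank x′ h′ → g ≡ g′
  rank-injective {x} h h′ refl eq = index-injective (R x) h h′ (Fin.inject≤-injective (≤ρ x) (≤ρ x) _ _ eq)
  code : Fin γ × Fin K → Fin (m * ρ)
  code y = combine (point y) (rank (point y) (g∈R y))
  code-injective : ∀ y y′ → code y ≡ code y′ → y ≡ y′
  code-injective y@(g , j) y′@(g′ , j′) eq with Fin.combine-injective (point y) _ (point y′) _ eq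
  ... | x≡ , r≡ with rank-injective (g∈R y) (g∈R y′) x≡ r≡
  ...   | refl = cong (g ,_) (Fin.inject≤-injective (K≤ g) (K≤ g) j j′ (element-injective (C g) x≡))

-- If every `f g` had more than T / 2 collisions, double counting over the T² pairs would give γ ≤ 2
-- T ρ. So some `f g` has at most T / 2, and at least half of its T arguments contribute new values.
large-image : ∀ {γ T n ρ} (f : Fin γ → Fin T → Fin n) (S : Subset n) → 0 < T → (∀ g t → f g t ∈ S) →
              (∀ x → ∣ comprehension (λ g → x ∈? collisions (f g)) ∣ ≤ ρ) → 2 * T * ρ < γ → T ≤ 2 * ∣ S ∣
large-image {γ} {T} {n} {ρ} f S 0<T f∈S ≤ρ 2Tρ<γ with Fin.any? (λ g → ∣ collisions (f g) ∣ ℕ.≤? T ℕ./ 2)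
... | yes (g , few) = ℕ.+-cancelʳ-≤ T T (2 * ∣ S ∣) (begin
  T + T                              ≡⟨ lemma T ⟩
  2 * T                              ≤⟨ ℕ.*-monoʳ-≤ 2 (image-size (f g) S (f∈S g)) ⟩
  2 * (∣ S ∣ + ∣ collisions (f g) ∣)  ≤⟨ ℕ.*-monoʳ-≤ 2 (ℕ.+-monoʳ-≤ ∣ S ∣ few) ⟩
  2 * (∣ S ∣ + T ℕ./ 2)              ≡⟨ lemma′ ∣ S ∣ (T ℕ./ 2) ⟩
  2 * ∣ S ∣ + T ℕ./ 2 * 2            ≤⟨ ℕ.+-monoʳ-≤ (2 * ∣ S ∣) (ℕ.m/n*n≤m T 2) ⟩
  2 * ∣ S ∣ + T                      ∎)
  where
  open ℕ.≤-Reasoning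
  lemma : ∀ t → t + t ≡ 2 * t
  lemma = ℕ.solve-∀
  lemma′ : ∀ s h → 2 * (s + h) ≡ 2 * s + h * 2
  lemma′ = ℕ.solve-∀
... | no ¬few = contradiction 2Tρ<γ (ℕ.≤⇒≯ (ℕ.*-cancelʳ-≤ γ (2 * T * ρ) T {{ℕ.>-nonZero 0<T}} (begin
  γ * T                       ≤⟨ ℕ.*-monoʳ-≤ γ T≤2K ⟩
  γ * (2 * K)                 ≡⟨ lemma γ K ⟩
  2 * (γ * K)
    ≤⟨ ℕ.*-monoʳ-≤ 2 (double-count (λ g → collisions (f g)) (λ g → ℕ.≰⇒> λ few → ¬few (g , few)) ≤ρ) ⟩
  2 * (T * T * ρ)             ≡⟨ lemma′ T ρ ⟩
  2 * T * ρ * T               ∎)))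
  where
  open ℕ.≤-Reasoning
  K = suc (T ℕ./ 2)
  T≤2K : T ≤ 2 * K
  T≤2K = begin
    T                          ≡⟨ ℕ.m≡m%n+[m/n]*n T 2 ⟩
    T ℕ.% 2 + T ℕ./ 2 * 2      ≤⟨ ℕ.+-monoˡ-≤ (T ℕ./ 2 * 2) (ℕ.<⇒≤ (ℕ.m%n<n T 2)) ⟩
    2 + T ℕ./ 2 * 2            ≡⟨ ℕ.*-comm K 2 ⟩
    2 * K                      ∎
  lemma : ∀ g k → g * (2 * k) ≡ 2 * (g * k)
  lemma = ℕ.solve-∀
  lemma′ : ∀ t r → 2 * (t * t * r) ≡ 2 * t * r * t
  lemma′ = ℕ.solve-∀

-- Tuples from disjoint blocks

-- The i-th entry from the right lies in the block [i b , (i + 1) b), so that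
-- distinct tuples differ as sets.
tuple : ∀ k {b} → Fin (b ^ k) → Vec ℕ k
tuple zero        t = []
tuple (suc k) {b} t = k * b + toℕ (quotient {b} (b ^ k) t) ∷ tuple k (remainder {b} (b ^ k) t)

tuple-bound : ∀ k {b} (t : Fin (b ^ k)) → All (_< k * b) (tuple k t)
tuple-bound zero        t = []
tuple-bound (suc k) {b} t =
  ℕ.<-≤-trans (ℕ.+-monoʳ-< (k * b) (Fin.toℕ<n (quotient {b} (b ^ k) t))) (ℕ.≤-reflexive (ℕ.+-comm (k * b) b)) ∷
  All.map (λ y<kb → ℕ.<-≤-trans y<kb (ℕ.m≤n+m (k * b) b)) (tuple-bound k (remainder {b} (b ^ k) t))

module TupleRoots (p : ℕ) .{{_ : NonZero p}} (p-prime : Prime p) where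

  open PrimeField p p-prime
  open Roots p p-prime

  ≢⇒≉ : ∀ {m n} → m < p → n < p → m ≢ n → ¬ + m ≈ + n
  ≢⇒≉ m<p n<p m≢n h = m≢n (+-≈-small h m<p n<p)

  below⇒≉ : ∀ {m x k} {ys : Vec ℕ k} → All (_< m) ys → m ≤ x → x < p → All (λ y → ¬ y ≈ + x) (map +_ ys)
  below⇒≉ ys<m m≤x x<p = All.map⁺ (All.map
    (λ y<m → let y<x = ℕ.<-≤-trans y<m m≤x in ≢⇒≉ (ℕ.<-trans y<x x<p) x<p (ℕ.<⇒≢ y<x)) ys<m)

  -- Take x from t at the leftmost position where the tuples differ. In both tuples the entries
  -- further left lie in higher blocks and those further right in lower ones, and the bound by p
  -- makes different entries incongruent.
  tuples-separated : ∀ k {b} → k * b ≤ p → (t t′ : Fin (b ^ k)) → t ≢ t′ →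
    ∃ λ x → x < k * b × Once (+ x) (map +_ (tuple k t)) × All (λ y → ¬ y ≈ + x) (map +_ (tuple k t′))
  tuples-separated zero        kb≤p zero zero t≢t′ = contradiction refl t≢t′
  tuples-separated (suc k) {b} kb≤p t t′ t≢t′ with quotient {b} (b ^ k) t Fin.≟ quotient {b} (b ^ k) t′
  ... | no h≢h′ = x , x<kb , head refl (below⇒≉ (tuple-bound k _) x≥ x<p) ,
        ≢⇒≉ (ℕ.<-≤-trans x′<kb kb≤p) x<p (λ eq → h≢h′ (sym (Fin.toℕ-injective (ℕ.+-cancelˡ-≡ (k * b) _ _ eq)))) ∷
        below⇒≉ (tuple-bound k _) x≥ x<p
    where
    x = k * b + toℕ (quotient {b} (b ^ k) t)
    x≥ = ℕ.m≤m+n (k * b) (toℕ (quotient {b} (b ^ k) t))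
    x<kb : x < suc k * b
    x<kb with y<kb ∷ _ ← tuple-bound (suc k) t = y<kb
    x′<kb : k * b + toℕ (quotient {b} (b ^ k) t′) < suc k * b
    x′<kb with y<kb ∷ _ ← tuple-bound (suc k) t′ = y<kb
    x<p = ℕ.<-≤-trans x<kb kb≤p
  ... | yes h≡h′ with tuples-separated k (ℕ.≤-trans (ℕ.m≤n+m (k * b) b) kb≤p)
                        (remainder {b} (b ^ k) t) (remainder {b} (b ^ k) t′)
                        (λ r≡r′ → t≢t′ (trans (sym (Fin.combine-remQuot {b} (b ^ k) t))
                          (trans (cong₂ combine h≡h′ r≡r′) (Fin.combine-remQuot {b} (b ^ k) t′))))
  ...   | x , x<kb , once , away = x , ℕ.<-≤-trans x<kb (ℕ.m≤n+m (k * b) b) , tail (head≉ t) once , head≉ t′ ∷ away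
    where
    head≉ : ∀ t → ¬ + (k * b + toℕ (quotient {b} (b ^ k) t)) ≈ + x
    head≉ t with y<kb ∷ _ ← tuple-bound (suc k) t =
      ≢⇒≉ (ℕ.<-≤-trans y<kb kb≤p) (ℕ.<-≤-trans x<kb (ℕ.≤-trans (ℕ.m≤n+m (k * b) b) kb≤p)) (λ eq → ℕ.<⇒≢ (ℕ.<-≤-trans x<kb (ℕ.m≤m+n (k * b) _)) (sym eq))

-- Sums of reciprocals along a progression

module Residues (p : ℕ) .{{_ : NonZero p}} (p-prime : Prime p) where

  open PrimeField p p-prime

  toℕ-residue : ∀ x → toℕ (residue {p} x) ≡ x ℤ.%ℕ p
  toℕ-residue x = Fin.toℕ-fromℕ< (ℤ.n%ℕd<d x p)

  residue-≈ : ∀ x → + toℕ (residue {p} x) ≈ x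
  residue-≈ x = ≈-trans (≈-reflexive (cong +_ (toℕ-residue x))) (%-≈ x)

  residue-injective : ∀ {x y} → residue {p} x ≡ residue {p} y → x ≈ y
  residue-injective {x} {y} eq =
    ≈-trans (≈-sym (residue-≈ x)) (≈-trans (≈-reflexive (cong (λ i → + toℕ i) eq)) (residue-≈ y))

  residue-cong : ∀ {x y} → x ≈ y → residue {p} x ≡ residue {p} y
  residue-cong {x} {y} h = Fin.toℕ-injective (+-≈-small
    (≈-trans (residue-≈ x) (≈-trans h (≈-sym (residue-≈ y)))) (Fin.toℕ<n (residue {p} x)) (Fin.toℕ<n (residue {p} y)))

  residue-∈-inverses : ∀ (I : Subset p) x → residue x ∈ I → ¬ x ≈ 0ℤ → residue (inv x) ∈ inverses I
  residue-∈-inverses I x x∈I x≉0 =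
    ∈-comprehension⁺ (λ y → Fin.any? λ x → (x ∈? I) ×-dec (x *ₚ y Fin.≟ 1ₚ))
      (residue x , x∈I , residue-cong (≈-trans (*-cong (residue-≈ x) (residue-≈ (inv x))) (*-inv x x≉0)))

  sum-inv : ℤ → ℤ → ∀ {k} → Vec ℕ k → ℤ
  sum-inv y q []       = 0ℤ
  sum-inv y q (x ∷ xs) = inv (y ℤ.+ q ℤ.* + x) ℤ.+ sum-inv y q xs

  sum-inv-∈ : ∀ (I : Subset p) y q {k} (xs : Vec ℕ k) →
    All (λ x → residue (y ℤ.+ q ℤ.* + x) ∈ I × ¬ y ℤ.+ q ℤ.* + x ≈ 0ℤ) xs →
    residue (sum-inv y q xs) ∈ sumset k (inverses I)
  sum-inv-∈ I y q {k} xs hs =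
    ∈-comprehension⁺ (λ s → anyVec? k λ ys → all? (_∈? inverses I) ys ×-dec (sumₚ ys Fin.≟ s)) (summands xs hs)
    where
    summands : ∀ {k} (xs : Vec ℕ k) → All (λ x → residue (y ℤ.+ q ℤ.* + x) ∈ I × ¬ y ℤ.+ q ℤ.* + x ≈ 0ℤ) xs →
               ∃ λ (ys : Vec (Fin p) k) → All (_∈ inverses I) ys × sumₚ ys ≡ residue (sum-inv y q xs)
    summands []       []                 = [] , [] , refl
    summands (x ∷ xs) ((w∈I , w≉0) ∷ hs) =
      let ys , ys∈ , eq = summands xs hs
          w = y ℤ.+ q ℤ.* + x
      in residue (inv w) ∷ ys , residue-∈-inverses I w w∈I w≉0 ∷ ys∈ ,
         trans (cong (residue (inv w) +ₚ_) eq) (residue-cong (+-cong (residue-≈ (inv w)) (residue-≈ (sum-inv y q xs))))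

  -- With z = y / q, the sum of the 1 / (y + q x) is 1 / q times the logarithmic
  -- derivative of the product of the z + x.
  prod-sum-inv : ∀ {z y q k} (xs : Vec ℕ k) → z ℤ.* q ≈ y → All (λ x → ¬ y ℤ.+ q ℤ.* + x ≈ 0ℤ) xs →
                 prod (map +_ xs) z ℤ.* (q ℤ.* sum-inv y q xs) ≈ prod′ (map +_ xs) z
  prod-sum-inv {q = q} []       zq≈y []           = ≈-reflexive (trans (ℤ.*-identityˡ _) (ℤ.*-zeroʳ q))
  prod-sum-inv {z} {y} {q} (x ∷ xs) zq≈y (w≉0 ∷ ws≉0) = begin
    (z ℤ.+ + x) ℤ.* P ℤ.* (q ℤ.* (inv w ℤ.+ s))                      ≡⟨ lemma z (+ x) P q (inv w) s ⟩
    P ℤ.* ((z ℤ.* q ℤ.+ q ℤ.* + x) ℤ.* inv w) ℤ.+ (z ℤ.+ + x) ℤ.* (P ℤ.* (q ℤ.* s))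
      ≈⟨ +-cong (*-congˡ P (≈-trans (*-congʳ (inv w) (+-cong zq≈y (≈-refl {q ℤ.* + x}))) (*-inv w w≉0)))
                (*-congˡ (z ℤ.+ + x) (prod-sum-inv xs zq≈y ws≉0)) ⟩
    P ℤ.* 1ℤ ℤ.+ (z ℤ.+ + x) ℤ.* prod′ (map +_ xs) z
      ≡⟨ cong (ℤ._+ (z ℤ.+ + x) ℤ.* prod′ (map +_ xs) z) (ℤ.*-identityʳ P) ⟩
    P ℤ.+ (z ℤ.+ + x) ℤ.* prod′ (map +_ xs) z                        ∎
    where
    open SetoidReasoning setoid
    w = y ℤ.+ q ℤ.* + x
    P = prod (map +_ xs) z
    s = sum-inv y q xs
    lemma : ∀ z x P q i s → (z ℤ.+ x) ℤ.* P ℤ.* (q ℤ.* (i ℤ.+ s)) ≡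
                            P ℤ.* ((z ℤ.* q ℤ.+ q ℤ.* x) ℤ.* i) ℤ.+ (z ℤ.+ x) ℤ.* (P ℤ.* (q ℤ.* s))
    lemma = solve-∀

  -- By `prod-sum-inv` the two derivatives are X s and Y s with the same s, which is q times the
  -- common sum, so the Wronskian becomes X s Y - Y s X.
  collision⇒root : ∀ {z y q k} (xs ys : Vec ℕ k) → z ℤ.* q ≈ y →
    All (λ x → ¬ y ℤ.+ q ℤ.* + x ≈ 0ℤ) xs → All (λ x → ¬ y ℤ.+ q ℤ.* + x ≈ 0ℤ) ys →
    sum-inv y q xs ≈ sum-inv y q ys → wronskian (map +_ xs) (map +_ ys) z ≈ 0ℤ
  collision⇒root {z} {y} {q} xs ys zq≈y xs≉0 ys≉0 eq = begin
    prod′ (map +_ xs) z ℤ.* Y ℤ.- prod′ (map +_ ys) z ℤ.* X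
      ≈⟨ -‿cong (*-congʳ Y (≈-sym (prod-sum-inv xs zq≈y xs≉0))) (*-congʳ X (≈-sym (prod-sum-inv ys zq≈y ys≉0))) ⟩
    X ℤ.* (q ℤ.* sum-inv y q xs) ℤ.* Y ℤ.- Y ℤ.* (q ℤ.* sum-inv y q ys) ℤ.* X
      ≈⟨ -‿cong (*-congʳ Y (*-congˡ X (*-congˡ q eq))) (≈-refl {Y ℤ.* (q ℤ.* sum-inv y q ys) ℤ.* X}) ⟩
    X ℤ.* (q ℤ.* sum-inv y q ys) ℤ.* Y ℤ.- Y ℤ.* (q ℤ.* sum-inv y q ys) ℤ.* X
      ≡⟨ lemma X Y (q ℤ.* sum-inv y q ys) ⟩
    0ℤ ∎
    where
    open SetoidReasoning setoid
    X = prod (map +_ xs) z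
    Y = prod (map +_ ys) z
    lemma : ∀ X Y s → X ℤ.* s ℤ.* Y ℤ.- Y ℤ.* s ℤ.* X ≡ 0ℤ
    lemma = solve-∀

-- Many sums from a box of fractions

module LargeSumset (p : ℕ) .{{_ : NonZero p}} (p-prime : Prime p)
                   (I : Subset p) (0∉I : 0ₚ ∉ I) (M : ℤ) (N : ℕ)
                   (M+j∈I : ∀ j → 1 ≤ j → j ≤ N → residue (M ℤ.+ + j) ∈ I) (N²<p : N * N < p) where

  open PrimeField p p-prime
  open Residues p p-prime

  M+j≉0 : ∀ j → 1 ≤ j → j ≤ N → ¬ M ℤ.+ + j ≈ 0ℤ
  M+j≉0 j 1≤j j≤N h = 0∉I (subst (_∈ I) (residue-cong h) (M+j∈I j 1≤j j≤N))

  -- The first element of the interval, so that offsets start at 0 and `u + q * x < N` is the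
  -- condition for staying inside.
  A : ℤ
  A = M ℤ.+ 1ℤ

  progression-∈ : ∀ {k} u q (xs : Vec ℕ k) → All (λ x → u + q * x < N) xs →
    All (λ x → residue (A ℤ.+ + u ℤ.+ + q ℤ.* + x) ∈ I × ¬ A ℤ.+ + u ℤ.+ + q ℤ.* + x ≈ 0ℤ) xs
  progression-∈ u q xs = All.map λ {x} lt →
    subst (λ w → residue w ∈ I × ¬ w ≈ 0ℤ) (eq x)
      (M+j∈I (suc (u + q * x)) (s≤s z≤n) lt , M+j≉0 (suc (u + q * x)) (s≤s z≤n) lt)
    where
    lemma : ∀ m u v → m ℤ.+ (1ℤ ℤ.+ (u ℤ.+ v)) ≡ m ℤ.+ 1ℤ ℤ.+ u ℤ.+ v
    lemma = solve-∀
    eq : ∀ x → M ℤ.+ + suc (u + q * x) ≡ A ℤ.+ + u ℤ.+ + q ℤ.* + x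
    eq x = trans (lemma M (+ u) (+ (q * x))) (cong (λ v → A ℤ.+ + u ℤ.+ v) (ℤ.pos-* q x))

  sumset-nonempty : ∀ k → 1 ≤ N → 1 ≤ ∣ sumset k (inverses I) ∣
  sumset-nonempty k 1≤N = ℕ.≤-trans (s≤s z≤n) (Fin.toℕ<n (index (sumset k (inverses I))
    (sum-inv-∈ I (A ℤ.+ + 0) (+ 0) zeros (progression-∈ 0 0 zeros (All.universal (λ _ → 1≤N) zeros)))))
    where zeros = replicate k 0

  -- The points x range below k b; u and q range over boxes of sides 3 U′ and 3 Q′
  -- such that M + 1 + u + q x stays in the interval.
  module _ (k b Q′ U′ : ℕ) (0<kb : 0 < k * b) (0<Q′ : 0 < Q′)
           (fits : 3 * U′ + 3 * Q′ * (k * b) ≤ N) where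

    Q≤N : 3 * Q′ ≤ N
    Q≤N = ℕ.≤-trans (ℕ.m≤m*n (3 * Q′) (k * b) {{ℕ.>-nonZero 0<kb}}) (ℕ.≤-trans (ℕ.m≤n+m _ (3 * U′)) fits)

    Q+U≤N : 3 * Q′ + 3 * U′ ≤ N
    Q+U≤N = ℕ.≤-trans (ℕ.≤-reflexive (ℕ.+-comm (3 * Q′) (3 * U′)))
      (ℕ.≤-trans (ℕ.+-monoʳ-≤ (3 * U′) (ℕ.m≤m*n (3 * Q′) (k * b) {{ℕ.>-nonZero 0<kb}})) fits)

    kb≤N : k * b ≤ N
    kb≤N = ℕ.≤-trans (ℕ.m≤n*m (k * b) (3 * Q′) {{ℕ.>-nonZero (ℕ.<-≤-trans 0<Q′ (ℕ.m≤m+n Q′ _))}})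
      (ℕ.≤-trans (ℕ.m≤n+m _ (3 * U′)) fits)

    N<p : N < p
    N<p = below N N²<p
      where
      below : ∀ n → n * n < p → n < p
      below zero    h = h
      below (suc n) h = ℕ.≤-<-trans (ℕ.m≤m*n (suc n) (suc n)) h

    -- From 2 Q U ≤ (Q + U)² and Q + U ≤ N, the hypothesis N² < p suffices.
    2QU≤p : 3 * Q′ * (3 * U′) + 3 * Q′ * (3 * U′) ≤ p
    2QU≤p = ℕ.≤-trans (square (3 * Q′) (3 * U′)) (ℕ.≤-trans (ℕ.*-mono-≤ Q+U≤N Q+U≤N) (ℕ.<⇒≤ N²<p))
      where
      lemma : ∀ a b → (a + b) * (a + b) ≡ a * b + a * b + (a * a + b * b)
      lemma = ℕ.solve-∀
      square : ∀ a b → a * b + a * b ≤ (a + b) * (a + b)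
      square a b = ℕ.≤-trans (ℕ.m≤m+n _ (a * a + b * b)) (ℕ.≤-reflexive (sym (lemma a b)))

    open Fractions p p-prime A Q′ U′ (ℕ.≤-<-trans Q≤N N<p)
      (ℕ.≤-<-trans (ℕ.≤-trans (ℕ.m≤n+m (3 * U′) (3 * Q′)) Q+U≤N) N<p) 2QU≤p using (module Rep)
    open FractionCount p p-prime A Q′ U′ (ℕ.≤-<-trans Q≤N N<p)
      (ℕ.≤-<-trans (ℕ.≤-trans (ℕ.m≤n+m (3 * U′) (3 * Q′)) Q+U≤N) N<p) 2QU≤p

    T = b ^ k

    progression : ∀ x (t : Fin T) → All (λ e → u-of x + q-of x * e < N) (tuple k t)
    progression x t = All.map (λ e<kb → ℕ.<-≤-trans
      (ℕ.+-mono-<-≤ (Rep.u<U (rep-of x)) (ℕ.*-mono-≤ (Rep.q≤Q (rep-of x)) (ℕ.<⇒≤ e<kb))) fits) (tuple-bound k t)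

    y-of : _ → ℤ
    y-of x = A ℤ.+ + u-of x

    f : Fin ∣ roots ∣ → Fin T → Fin p
    f g t = residue (sum-inv (y-of (element roots g)) (+ q-of (element roots g)) (tuple k t))

    f-∈ : ∀ g t → f g t ∈ sumset k (inverses I)
    f-∈ g t = sum-inv-∈ I _ _ (tuple k t) (progression-∈ (u-of x) (q-of x) (tuple k t) (progression x t))
      where x = element roots g

    -- A fixed pair of tuples collides at g only if the fraction of g is a root of their Wronskian,
    -- and different roots g have incongruent fractions; 2 k + 1 of them would contradict
    -- `wronskian-roots`.
    few-roots : ∀ x → ∣ comprehension (λ g → x ∈? collisions (f g)) ∣ ≤ k + k
    few-roots x = ℕ.≮⇒≥ λ many → impossible (subst (_≤ ∣ R ∣) (sym (ℕ.+-suc k k)) many)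
      where
      R = comprehension (λ g → x ∈? collisions (f g))
      t = remainder {T} T x
      t′ = quotient {T} T x
      impossible : ¬ k + suc k ≤ ∣ R ∣
      impossible le = wronskian-roots once away (λ i → z-of (root-at i)) distinct vanishes
        where
        open Roots p p-prime using (wronskian-roots)
        open TupleRoots p p-prime using (tuples-separated)
        g-at : Fin (k + suc k) → Fin ∣ roots ∣
        g-at i = element R (Fin.inject≤ i le)
        root-at : Fin (k + suc k) → _
        root-at i = element roots (g-at i)
        isRoot-at : ∀ i → IsRoot (root-at i)
        isRoot-at i = ∈-comprehension⁻ isRoot? (element-∈ roots (g-at i))
        collision-at : ∀ i → t Fin.< t′ × f (g-at i) t ≡ f (g-at i) t′
        collision-at i = ∈-comprehension⁻ (collides? (f (g-at i)))
          (∈-comprehension⁻ (λ g → x ∈? collisions (f g)) (element-∈ R (Fin.inject≤ i le)))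
        distinct : ∀ {i j} → z-of (root-at i) ≈ z-of (root-at j) → i ≡ j
        distinct {i} {j} h = Fin.inject≤-injective le le i j
          (element-injective R (element-injective roots (roots-distinct (isRoot-at i) (isRoot-at j) h)))
        nonzero : ∀ x (t : Fin T) → All (λ e → ¬ y-of x ℤ.+ + q-of x ℤ.* + e ≈ 0ℤ) (tuple k t)
        nonzero x t = All.map proj₂ (progression-∈ (u-of x) (q-of x) (tuple k t) (progression x t))
        vanishes : ∀ i → wronskian (map +_ (tuple k t)) (map +_ (tuple k t′)) (z-of (root-at i)) ≈ 0ℤ
        vanishes i = collision⇒root (tuple k t) (tuple k t′) (Rep.zq≈ (rep-of (root-at i)))
          (nonzero (root-at i) t) (nonzero (root-at i) t′) (residue-injective (proj₂ (collision-at i)))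
        -- That the two tuples are different is read off from any one collision; `k + suc k` is
        -- positive, so one exists.
        first : Fin (k + suc k)
        first = subst Fin (sym (ℕ.+-suc k k)) zero
        separated = tuples-separated k (ℕ.≤-trans kb≤N (ℕ.<⇒≤ N<p)) t t′
          (λ eq → ℕ.<⇒≢ (proj₁ (collision-at first)) (cong toℕ eq))
        once = proj₁ (proj₂ (proj₂ separated))
        away = proj₂ (proj₂ (proj₂ separated))

    -- The threshold is 2 T ρ from `large-image` with T = b^k and ρ = 2 k.
    sumset-large : 0 < b → 4 * k * b ^ k < Q′ * U′ → b ^ k ≤ 2 * ∣ sumset k (inverses I) ∣
    sumset-large 0<b bound = large-image f (sumset k (inverses I)) (ℕ.m^n>0 b {{ℕ.>-nonZero 0<b}} k) f-∈ few-roots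
      (ℕ.<-≤-trans (subst (_< Q′ * U′) (lemma k T) bound) roots-many)
      where
      lemma : ∀ k t → 4 * k * t ≡ 2 * t * (k + k)
      lemma = ℕ.solve-∀

-- Choice of b, Q′ and U′

last-true : ∀ {P : Pred ℕ 0ℓ} → Decidable P → P 1 → ∀ n → ¬ P (suc n) → ∃ λ b → 0 < b × P b × ¬ P (suc b)
last-true P? p1 zero    ¬p = contradiction p1 ¬p
last-true P? p1 (suc n) ¬p with P? (suc n)
... | yes p = suc n , s≤s z≤n , p , ¬p
... | no ¬q = last-true P? p1 n ¬q

m<suc[m/n]*n : ∀ m n .{{_ : NonZero n}} → m < suc (m ℕ./ n) * n
m<suc[m/n]*n m n = ℕ.≤-<-trans (ℕ.≤-reflexive (ℕ.m≡m%n+[m/n]*n m n)) (ℕ.+-monoˡ-< (m ℕ./ n * n) (ℕ.m%n<n m n))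

m<2[m/n]*n : ∀ {m n} .{{_ : NonZero n}} → n ≤ m → m < 2 * (m ℕ./ n) * n
m<2[m/n]*n {m} {n} n≤m = ℕ.<-≤-trans (m<suc[m/n]*n m n) (ℕ.*-monoˡ-≤ n
  (ℕ.≤-trans (ℕ.+-monoˡ-≤ (m ℕ./ n) (ℕ.m≥n⇒m/n>0 n≤m)) (ℕ.≤-reflexive (lemma (m ℕ./ n)))))
  where
  lemma : ∀ a → a + a ≡ 2 * a
  lemma = ℕ.solve-∀

^-distribʳ-* : ∀ m n k → (m * n) ^ k ≡ m ^ k * n ^ k
^-distribʳ-* m n zero    = refl
^-distribʳ-* m n (suc k) = trans (cong (m * n *_) (^-distribʳ-* m n k)) (lemma m n (m ^ k) (n ^ k))
  where
  lemma : ∀ m n a b → m * n * (a * b) ≡ m * a * (n * b)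
  lemma = ℕ.solve-∀

module Parameters (p : ℕ) .{{_ : NonZero p}} (p-prime : Prime p)
                  (I : Subset p) (0∉I : 0ₚ ∉ I) (M : ℤ) (N : ℕ)
                  (M+j∈I : ∀ j → 1 ≤ j → j ≤ N → residue (M ℤ.+ + j) ∈ I) (N²<p : N * N < p)
                  (1≤N : 1 ≤ N) (k′ : ℕ) where

  open LargeSumset p p-prime I 0∉I M N M+j∈I N²<p

  k = suc k′

  -- Rounding down loses at most a factor 2, so U′ ≥ N / 12 and Q′ ≥ N / (12 k b). Then Q′ U′ ≥ N² /
  -- (144 k b), which exceeds the 4 k b^k of `sumset-large` when N² > 576 k² b^(k+1).
  Small : ℕ → Set
  Small b = 576 * (k * k) * b ^ suc k < N * N

  small-bound : ∀ b → 0 < b → Small b → b ^ k ≤ 2 * ∣ sumset k (inverses I) ∣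
  small-bound b 0<b small =
    sumset-large k b Q′ U′ 0<kb 0<Q′ fits 0<b (ℕ.*-cancelˡ-< (144 * (k * b)) _ _ (begin-strict
    144 * (k * b) * (4 * k * b ^ k)               ≡⟨ lemma k b (b ^ k) ⟩
    576 * (k * k) * b ^ suc k                     <⟨ small ⟩
    N * N                                         ≤⟨ ℕ.*-mono-≤ (ℕ.<⇒≤ (m<2[m/n]*n 6≤N)) (ℕ.<⇒≤ (m<2[m/n]*n 6kb≤N)) ⟩
    2 * U′ * 6 * (2 * Q′ * (6 * (k * b)))         ≡⟨ lemma′ U′ Q′ (k * b) ⟩
    144 * (k * b) * (Q′ * U′)                     ∎))
    where
    open ℕ.≤-Reasoning
    0<kb : 0 < k * b
    0<kb = ℕ.<-≤-trans 0<b (ℕ.m≤m+n b (k′ * b))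
    instance
      kb≢0 : NonZero (k * b)
      kb≢0 = ℕ.>-nonZero 0<kb
      6kb≢0 : NonZero (6 * (k * b))
      6kb≢0 = ℕ.m*n≢0 6 (k * b)
    -- Each of the two terms in `fits` receives half of N.
    U′ = N ℕ./ 6
    Q′ = N ℕ./ (6 * (k * b))
    lemma : ∀ k b c → 144 * (k * b) * (4 * k * c) ≡ 576 * (k * k) * (b * c)
    lemma = ℕ.solve-∀
    lemma′ : ∀ u q c → 2 * u * 6 * (2 * q * (6 * c)) ≡ 144 * c * (q * u)
    lemma′ = ℕ.solve-∀
    lemma″ : ∀ k b → 576 * (k * k) * (b * b) ≡ 24 * (k * b) * (24 * (k * b))
    lemma″ = ℕ.solve-∀
    b≤b^k : b ≤ b ^ k
    b≤b^k = ℕ.m≤m*n b (b ^ k′) {{ℕ.m^n≢0 b k′ {{ℕ.>-nonZero 0<b}}}}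
    -- As k ≥ 1, b^(k+1) ≥ b², and 576 = 24². The result keeps both quotients `U′` and `Q′`
    -- positive.
    24kb<N : 24 * (k * b) < N
    24kb<N = ℕ.≰⇒> λ N≤ → ℕ.<⇒≱ small (begin
      N * N                                 ≤⟨ ℕ.*-mono-≤ N≤ N≤ ⟩
      24 * (k * b) * (24 * (k * b))         ≡⟨ lemma″ k b ⟨
      576 * (k * k) * (b * b)               ≤⟨ ℕ.*-monoʳ-≤ (576 * (k * k)) (ℕ.*-monoʳ-≤ b b≤b^k) ⟩
      576 * (k * k) * b ^ suc k             ∎)
    6kb≤N : 6 * (k * b) ≤ N
    6kb≤N = ℕ.≤-trans (ℕ.*-monoˡ-≤ (k * b) {6} {24} (ℕ.m≤m+n 6 18)) (ℕ.<⇒≤ 24kb<N)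
    6≤N : 6 ≤ N
    6≤N = ℕ.≤-trans (ℕ.m≤m*n 6 (k * b)) 6kb≤N
    0<Q′ : 0 < Q′
    0<Q′ = ℕ.m≥n⇒m/n>0 6kb≤N
    fits : 3 * U′ + 3 * Q′ * (k * b) ≤ N
    fits = ℕ.*-cancelˡ-≤ 2 (begin
      2 * (3 * U′ + 3 * Q′ * (k * b))        ≡⟨ lemma‴ U′ Q′ (k * b) ⟩
      U′ * 6 + Q′ * (6 * (k * b))            ≤⟨ ℕ.+-mono-≤ (ℕ.m/n*n≤m N 6) (ℕ.m/n*n≤m N (6 * (k * b))) ⟩
      N + N                                  ≡⟨ cong (λ v → N + v) (sym (ℕ.+-identityʳ N)) ⟩
      2 * N                                  ∎)
      where
      lemma‴ : ∀ u q c → 2 * (3 * u + 3 * q * c) ≡ u * 6 + q * (6 * c)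
      lemma‴ = ℕ.solve-∀

  -- Take b small with b + 1 not small; it exists below N because N² ≤ N^(k+1). The factor 2 comes
  -- from b + 1 ≤ 2 b. If even 1 is not small, b = 1 serves, since the sumset is nonempty.
  optimal-b : ∃ λ b → N * N ≤ 576 * (k * k) * (2 * b) ^ suc k × b ^ k ≤ 2 * ∣ sumset k (inverses I) ∣
  optimal-b with small? 1
    where
    small? : Decidable Small
    small? b = _ ℕ.<? _
  ... | no ¬small = 1 ,
        ℕ.≤-trans (ℕ.≮⇒≥ ¬small) (ℕ.*-monoʳ-≤ (576 * (k * k)) (ℕ.^-monoˡ-≤ (suc k) {1} {2} (s≤s z≤n))) ,
        ℕ.≤-trans (ℕ.≤-reflexive (ℕ.^-zeroˡ k)) (ℕ.≤-trans (sumset-nonempty k 1≤N) (ℕ.m≤m+n _ _))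
  ... | yes small with last-true {Small} (λ b → _ ℕ.<? _) small (ℕ.pred N) ¬small[N]
    where
    ¬small[N] : ¬ Small (suc (ℕ.pred N))
    ¬small[N] = subst (λ n → ¬ Small n) (sym (ℕ.suc-pred N {{ℕ.>-nonZero 1≤N}})) (ℕ.≤⇒≯ (ℕ.≤-trans
      (ℕ.*-monoʳ-≤ N (ℕ.m≤m*n N (N ^ k′) {{ℕ.m^n≢0 N k′ {{ℕ.>-nonZero 1≤N}}}}))
      (ℕ.m≤n*m (N ^ suc k) (576 * (k * k)))))
  ...   | b , 0<b , small-b , ¬small =  b ,
          ℕ.≤-trans (ℕ.≮⇒≥ ¬small) (ℕ.*-monoʳ-≤ (576 * (k * k)) (ℕ.^-monoˡ-≤ (suc k)
            (ℕ.≤-trans (ℕ.+-monoˡ-≤ b 0<b) (ℕ.≤-reflexive (cong (λ v → b + v) (sym (ℕ.+-identityʳ b))))))) ,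
          small-bound b 0<b small-b

-- Elimination of b

constant : ℕ → ℕ
constant k = 2 * suc ((576 * (k * k) * 2 ^ suc k) ^ k)

-- Raising the two bounds to the powers k and k + 1 produces b^(k(k+1)) in both. The factor Y left
-- over is replaced by (Y + 1)^(k+1), which avoids a root and makes the inequality strict; this is
-- the origin of `constant`.
power-bound : ∀ {N S} k b → 1 ≤ S → N * N ≤ 576 * (k * k) * (2 * b) ^ suc k → b ^ k ≤ 2 * S →
              N ^ (2 * k) < (constant k * S) ^ suc k
power-bound {N} {S} k b 1≤S N²≤ b^k≤ = begin-strict
  N ^ (2 * k)                                    ≡⟨ ℕ.^-*-assoc N 2 k ⟨
  (N ^ 2) ^ k                                    ≡⟨ cong (λ v → (N * v) ^ k) (ℕ.*-identityʳ N) ⟩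
  (N * N) ^ k                                    ≤⟨ ℕ.^-monoˡ-≤ k N²≤ ⟩
  (576 * (k * k) * (2 * b) ^ suc k) ^ k          ≡⟨ cong (λ v → (c * v) ^ k) (^-distribʳ-* 2 b (suc k)) ⟩
  (576 * (k * k) * (2 ^ suc k * b ^ suc k)) ^ k  ≡⟨ cong (_^ k) (ℕ.*-assoc c (2 ^ suc k) (b ^ suc k)) ⟨
  (576 * (k * k) * 2 ^ suc k * b ^ suc k) ^ k    ≡⟨ ^-distribʳ-* (576 * (k * k) * 2 ^ suc k) (b ^ suc k) k ⟩
  Y * (b ^ suc k) ^ k                            ≡⟨ cong (Y *_) (ℕ.^-*-assoc b (suc k) k) ⟩
  Y * b ^ (suc k * k)                            ≡⟨ cong (λ v → Y * b ^ v) (ℕ.*-comm (suc k) k) ⟩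
  Y * b ^ (k * suc k)                            ≡⟨ cong (Y *_) (ℕ.^-*-assoc b k (suc k)) ⟨
  Y * (b ^ k) ^ suc k                            ≤⟨ ℕ.*-monoʳ-≤ Y (ℕ.^-monoˡ-≤ (suc k) b^k≤) ⟩
  Y * (2 * S) ^ suc k                            <⟨ ℕ.*-monoˡ-< ((2 * S) ^ suc k) (ℕ.n<1+n Y) ⟩
  suc Y * (2 * S) ^ suc k                        ≤⟨ ℕ.*-monoˡ-≤ ((2 * S) ^ suc k) (ℕ.m≤m*n (suc Y) (suc Y ^ k)) ⟩
  suc Y ^ suc k * (2 * S) ^ suc k                ≡⟨ ^-distribʳ-* (suc Y) (2 * S) (suc k) ⟨
  (suc Y * (2 * S)) ^ suc k                      ≡⟨ cong (_^ suc k) (lemma (suc Y) S) ⟩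
  (constant k * S) ^ suc k                       ∎
  where
  open ℕ.≤-Reasoning
  c = 576 * (k * k)
  Y = (c * 2 ^ suc k) ^ k
  instance
    S≢0 : NonZero S
    S≢0 = ℕ.>-nonZero 1≤S
    2S≢0 : NonZero (2 * S)
    2S≢0 = ℕ.m*n≢0 2 S
    [2S]^≢0 : NonZero ((2 * S) ^ suc k)
    [2S]^≢0 = ℕ.m^n≢0 (2 * S) (suc k)
    Y^≢0 : NonZero (suc Y ^ k)
    Y^≢0 = ℕ.m^n≢0 (suc Y) k
  lemma : ∀ y s → y * (2 * s) ≡ 2 * y * s
  lemma = ℕ.solve-∀

interval-size : ∀ {p} .{{_ : NonZero p}} (I : Subset p) (M : ℤ) N →
                (∀ x → x ∈ I → ∃ λ j → 1 ≤ j × j ≤ N × x ≡ residue (M ℤ.+ + j)) → ∣ I ∣ ≤ N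
interval-size {p} I M N offset = Fin.injective⇒≤ {f = code} code-injective
  where
  spec : ∀ i → ∃ λ j → 1 ≤ j × j ≤ N × element I i ≡ residue (M ℤ.+ + j)
  spec i = offset (element I i) (element-∈ I i)
  pred<N : ∀ {j} → 1 ≤ j → j ≤ N → ℕ.pred j < N
  pred<N {suc j} _ j<N = j<N
  code : Fin ∣ I ∣ → Fin N
  code i with j , 1≤j , j≤N , _ ← spec i = Fin.fromℕ< (pred<N 1≤j j≤N)
  code-injective : ∀ {i i′} → code i ≡ code i′ → i ≡ i′
  code-injective {i} {i′} eq with spec i | spec i′
  ... | suc j , _ , j<N , x≡ | suc j′ , _ , j′<N , x′≡ = element-injective I (trans x≡
        (trans (cong (λ n → residue (M ℤ.+ + suc n)) (Fin.fromℕ<-injective j j′ j<N j′<N eq)) (sym x′≡)))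

sumset-power-bound : ∀ k .{{_ : NonZero k}} p .{{_ : NonZero p}} → Prime p → (I : Subset p) → IsInterval I →
                     0ₚ ∉ I → ∣ I ∣ ^ 2 < p → ∣ I ∣ ^ (2 * k) < (constant k * ∣ sumset k (inverses I) ∣) ^ suc k
sumset-power-bound k@(suc k′) p p-prime I (M , N , 1≤N , _ , I⇔) 0∉I I²<p =
  let b , N²≤ , b^k≤ = Parameters.optimal-b p p-prime I 0∉I M ∣ I ∣ M+j∈I I*I<p 1≤I k′
  in power-bound {∣ I ∣} k b (LargeSumset.sumset-nonempty p p-prime I 0∉I M ∣ I ∣ M+j∈I I*I<p k 1≤I) N²≤ b^k≤
  where
  I*I<p : ∣ I ∣ * ∣ I ∣ < p
  I*I<p = subst (_< p) (cong (∣ I ∣ *_) (ℕ.*-identityʳ ∣ I ∣)) I²<p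
  -- The argument runs with `∣ I ∣` in place of the length N of the interval; `interval-size` keeps
  -- these offsets within it.
  M+j∈I : ∀ j → 1 ≤ j → j ≤ ∣ I ∣ → residue (M ℤ.+ + j) ∈ I
  M+j∈I j 1≤j j≤I = Equivalence.from (I⇔ _)
    (j , 1≤j , ℕ.≤-trans j≤I (interval-size I M N (λ x → Equivalence.to (I⇔ x))) , refl)
  1≤I : 1 ≤ ∣ I ∣
  1≤I = ℕ.≤-trans (s≤s z≤n) (Fin.toℕ<n (index I (Equivalence.from (I⇔ _) (1 , ℕ.≤-refl , 1≤N , refl))))

-- Passage to rational exponents and a real constant

fromℚ : ℚ → ℝ
fromℚ r = record
  { lower           = ℚ._< r
  ; upper           = r ℚ.<_
  ; lower-inhabited = r ℚ.- ℚ.1ℚ ,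
      subst (r ℚ.- ℚ.1ℚ ℚ.<_) (ℚ.+-identityʳ r) (ℚ.+-monoʳ-< r (ℚ.negative⁻¹ (ℚ.- ℚ.1ℚ)))
  ; upper-inhabited = r ℚ.+ ℚ.1ℚ ,
      subst (ℚ._< r ℚ.+ ℚ.1ℚ) (ℚ.+-identityʳ r) (ℚ.+-monoʳ-< r (ℚ.positive⁻¹ ℚ.1ℚ))
  ; lower-rounded   = λ q → mk⇔ ℚ.<-dense (λ (s , q<s , s<r) → ℚ.<-trans q<s s<r)
  ; upper-rounded   = λ q → mk⇔ (λ r<q → let s , r<s , s<q = ℚ.<-dense r<q in s , s<q , r<s)
                                (λ (s , s<q , r<s) → ℚ.<-trans r<s s<q)
  ; disjoint        = λ q (q<r , r<q) → ℚ.<-asym q<r r<q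
  ; located         = located-at
  }
  where
  located-at : ∀ {q s} → q ℚ.< s → q ℚ.< r ⊎ r ℚ.< s
  located-at {q} q<s with ℚ.<-cmp q r
  ... | tri< q<r _ _  = inj₁ q<r
  ... | tri≈ _ refl _ = inj₂ q<s
  ... | tri> _ _ r<q  = inj₂ (ℚ.<-trans r<q q<s)

fromℕ≡mkℚ : ∀ n → fromℕ n ≡ mkℚ (+ n) 0 (Coprime.sym (1-coprimeTo n))
fromℕ≡mkℚ n = ℚ.normalize-coprime (Coprime.sym (1-coprimeTo n))

fromℕ-mono-< : ∀ {m n} → m < n → fromℕ m ℚ.< fromℕ n
fromℕ-mono-< {m} {n} m<n = subst₂ ℚ._<_ (sym (fromℕ≡mkℚ m)) (sym (fromℕ≡mkℚ n))
  (ℚ.*<* (ℤ.*-monoʳ-<-pos 1ℤ (ℤ.+<+ m<n)))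

fromℕ-* : ∀ m n → fromℕ m ℚ.* fromℕ n ≡ fromℕ (m * n)
fromℕ-* m n = trans (cong₂ ℚ._*_ (fromℕ≡mkℚ m) (fromℕ≡mkℚ n)) (cong (_/ 1) (sym (ℤ.pos-* m n)))

fromℕ-^ : ∀ m n → fromℕ m ^ℚ n ≡ fromℕ (m ^ n)
fromℕ-^ m zero    = refl
fromℕ-^ m (suc n) = trans (cong (fromℕ m ℚ.*_) (fromℕ-^ m n)) (fromℕ-* m (m ^ n))

^-cancel-< : ∀ {m n} k → m ^ k < n ^ k → m < n
^-cancel-< k h = ℕ.≰⇒> λ n≤m → ℕ.<⇒≱ h (ℕ.^-monoˡ-≤ k n≤m)

rationalPower< : ∀ {N t n} s → ℚ.↥ s ≡ + n → ℚ.0ℚ ℚ.< t → fromℕ (N ^ n) ℚ.< t ^ℚ ℚ.↧ₙ s → RationalPower< N s t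
rationalPower< (mkℚ _ _ _) refl 0<t h = 0<t , h

-- `RationalPower<` reads numerator and denominator in lowest terms. With g the gcd of m and n, both
-- sides of the hypothesis are g-th powers, and g cancels from the exponents.
power<⇒rationalPower< : ∀ {N u} m n .{{_ : NonZero n}} → 0 < u → N ^ m < u ^ n → RationalPower< N (+ m / n) (fromℕ u)
power<⇒rationalPower< {N} {u} m n 0<u h =
  rationalPower< s numerator (fromℕ-mono-< 0<u) (subst (fromℕ (N ^ ℤ.∣ ℚ.↥ s ∣) ℚ.<_) (sym (fromℕ-^ u (ℚ.↧ₙ s)))
    (fromℕ-mono-< (^-cancel-< g (subst₂ _<_ (power N ℤ.∣ ℚ.↥ s ∣ m ↥g≡m) (power u (ℚ.↧ₙ s) n ↧g≡n) h))))
  where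
  s = + m / n
  g = gcd m n
  ↥g≡m : ℤ.∣ ℚ.↥ s ∣ * g ≡ m
  ↥g≡m = trans (sym (ℤ.abs-* (ℚ.↥ s) (+ g))) (cong ℤ.∣_∣ (ℚ.↥-/ (+ m) n))
  ↧g≡n : ℚ.↧ₙ s * g ≡ n
  ↧g≡n = trans (sym (ℤ.abs-* (ℚ.↧ s) (+ g))) (cong ℤ.∣_∣ (ℚ.↧-/ (+ m) n))
  power : ∀ x a c → a * g ≡ c → x ^ c ≡ (x ^ a) ^ g
  power x a _ refl = sym (ℕ.^-*-assoc x a g)
  numerator : ℚ.↥ s ≡ + ℤ.∣ ℚ.↥ s ∣
  numerator = nonneg s (ℚ.normalize-nonNeg m n)
    where
    nonneg : ∀ s → ℚ.NonNegative s → ℚ.↥ s ≡ + ℤ.∣ ℚ.↥ s ∣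
    nonneg (mkℚ (+ _) _ _) _ = refl

corollary1 : (k : ℕ) .{{_ : NonZero k}} (ε : ℝ) → Positive ε →
    Σ[ c ∈ ℝ ] Positive c ×
    (∀ (p : ℕ) .{{_ : NonZero p}} → Prime p →
    ∀ (I : Subset p) → IsInterval I → 0ₚ ∉ I → ∣ I ∣ ^ 2 < p →
    c · (∣ I ∣ ^ᵁ (+ (2 * k) / suc k ⊖ ε)) ≺ fromℕ ∣ sumset k (inverses I) ∣)
corollary1 k ε ε>0 = fromℚ r , 0<r , λ p p-prime I interval 0∉I I²<p →
  let S = ∣ sumset k (inverses I) ∣
      bound = sumset-power-bound k p p-prime I interval 0∉I I²<p
      0<CS = positive-base (constant k * S) (ℕ.≤-<-trans z≤n bound)
      -- As ε > 0, the exponent 2 k / (k + 1) itself is a rational above 2 k / (k + 1) - ε, so the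
      -- bound without ε applies.
      s = + (2 * k) / suc k
  in d , fromℕ (constant k * S) , r<d ,
     (s , subst (lower ε) (sym (ℚ.+-inverseʳ s)) ε>0 , power<⇒rationalPower< (2 * k) (suc k) 0<CS bound) ,
     ℚ.≤-reflexive (begin
       d ℚ.* fromℕ (constant k * S)                 ≡⟨ cong (d ℚ.*_) (fromℕ-* (constant k) S) ⟨
       d ℚ.* (fromℕ (constant k) ℚ.* fromℕ S)       ≡⟨ ℚ.*-assoc d (fromℕ (constant k)) (fromℕ S) ⟨
       d ℚ.* fromℕ (constant k) ℚ.* fromℕ S         ≡⟨ cong (λ v → d ℚ.* v ℚ.* fromℕ S) (fromℕ≡mkℚ (constant k)) ⟩
       d ℚ.* C ℚ.* fromℕ S                          ≡⟨ cong (ℚ._* fromℕ S) (ℚ.*-inverseˡ C) ⟩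
       ℚ.1ℚ ℚ.* fromℕ S                             ≡⟨ ℚ.*-identityˡ (fromℕ S) ⟩
       fromℕ S                                      ∎)
  where
  open ≡-Reasoning
  C d r : ℚ
  C = mkℚ (+ constant k) 0 (Coprime.sym (1-coprimeTo (constant k)))
  d = ℚ.1/ C
  -- The product of c with a cut asks for a rational strictly above c. Choosing c strictly between 0
  -- and 1 / C lets d = 1 / C play that part, and d cancels the factor C.
  r = proj₁ (ℚ.<-dense (ℚ.positive⁻¹ d))
  0<r = proj₁ (proj₂ (ℚ.<-dense (ℚ.positive⁻¹ d)))
  r<d = proj₂ (proj₂ (ℚ.<-dense (ℚ.positive⁻¹ d)))
  positive-base : ∀ m → 0 < m ^ suc k → 0 < m
  positive-base (suc m) _ = s≤s z≤n
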